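{- Let $t\geq 1$. For simple graphs $G$ and $H$, the following are equivalent: 1. $G$ and $H$ are not distinguished by the $t$-dimensional $\mathsf{mwl}$ algorithm; 2. $G$ and $H$ are homomorphism indistinguishable over $\mathcal{L}_t^+$; 3. $G$ and $H$ satisfy the same $\mathsf{M}^t$-sentences.
   Context: Graphs are finite, undirected, without multiple edges, and may have loops; simple means loopless. $\hom(F,G)$ is the number of homomorphisms from $F$ to $G$. $\mathfrak{S}_{2t}$ is the symmetric group; for a $2t$-tuple $\boldsymbol{x}$, $\sigma(\boldsymbol{x})$ is the tuple with entries permuted according to $\sigma$. Concatenation of tuples $\boldsymbol{r},\boldsymbol{s}$ is written $\boldsymbol{r}\boldsymbol{s}$. The mwl algorithm. The atomic type $\mathrm{atp}_G(x_1,\dots,x_{2t})$ of a tuple of vertices records which $x_i,x_j$ are equal and which are adjacent: $\mathrm{atp}_G(x_1,\dots,x_{2t})=\mathrm{atp}_H(y_1,\dots,y_{2t})$ iff for all $i,j$, $x_i=x_j\Leftrightarrow y_i=y_j$ and $x_ix_j\in E(G)\Leftrightarrow y_iy_j\in E(H)$. For $\boldsymbol{r},\boldsymbol{s}\in V(G)^t$ and $i\geq 1$ define $\mathsf{mwl}^0_G(\boldsymbol{r}\boldsymbol{s}) := \mathrm{atp}_G(\boldsymbol{r}\boldsymbol{s})$, $\mathsf{mwl}^{i-1/2}_G(\boldsymbol{r}\boldsymbol{s}) := (\mathsf{mwl}^{i-1}_G(\sigma(\boldsymbol{r}\boldsymbol{s})) \mid \sigma\in\mathfrak{S}_{2t})$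 (a family indexed by $\sigma$), and $\mathsf{mwl}^i_G(\boldsymbol{r}\boldsymbol{s})$ as the pair consisting of $\mathsf{mwl}^{i-1/2}_G(\boldsymbol{r}\boldsymbol{s})$ and the multiset of all pairs $(\mathsf{mwl}^{i-1/2}_G(\boldsymbol{r}\boldsymbol{t}),\mathsf{mwl}^{i-1/2}_G(\boldsymbol{t}\boldsymbol{s}))$ for $\boldsymbol{t}\in V(G)^t$. These are increasingly fine colourings of $V(G)^{2t}$; $\mathsf{mwl}^\infty_G$ denotes the finest (stable) colouring, where $\mathsf{mwl}^\infty_G(\boldsymbol{r}\boldsymbol{s})=\mathsf{mwl}^\infty_H(\boldsymbol{u}\boldsymbol{v})$ means $\mathsf{mwl}^i_G(\boldsymbol{r}\boldsymbol{s})=\mathsf{mwl}^i_H(\boldsymbol{u}\boldsymbol{v})$ for all $i\in\mathbb{N}$. $G$ and $H$ are not distinguished by the $t$-dimensional $\mathsf{mwl}$ algorithm if the multisets of colours $\mathsf{mwl}^\infty_G(\boldsymbol{r}\boldsymbol{s})$, $\boldsymbol{r},\boldsymbol{s}\in V(G)^t$, and $\mathsf{mwl}^\infty_H(\boldsymbol{u}\boldsymbol{v})$, $\boldsymbol{u},\boldsymbol{v}\in V(H)^t$, are the same. The class $\mathcal{L}_t^+$. A $(t,t)$-bilabelled graph is a tuple $\boldsymbol{F}=(F,\boldsymbol{u},\boldsymbol{v})$ with $F$ a graph and $\boldsymbol{u},\boldsymbol{v}\in V(F)^t$ (in-labels, out-labels). The series composition of $(F,\boldsymbol{u},\boldsymbol{v})$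 and $(F',\boldsymbol{u}',\boldsymbol{v}')$ is obtained from the disjoint union of $F$ and $F'$ by identifying $\boldsymbol{v}_i$ with $\boldsymbol{u}'_i$ for all $i$, with in-labels $\boldsymbol{u}$ and out-labels $\boldsymbol{v}'$. The parallel composition is obtained by identifying $\boldsymbol{u}_i$ with $\boldsymbol{u}'_i$ and $\boldsymbol{v}_i$ with $\boldsymbol{v}'_i$ for all $i$, with in-labels $\boldsymbol{u}$ and out-labels $\boldsymbol{v}$. Multiple edges are removed, loops kept. $\mathfrak{S}_{2t}$ acts by permuting the $2t$ labels. A $(t,t)$-bilabelled graph is atomic if all its vertices are labelled; $\mathcal{A}_t$ is the set of these. $\mathcal{L}_t^+$ is the class of $(t,t)$-bilabelled graphs generated by $\mathcal{A}_t$ under parallel composition, series composition, and the action of $\mathfrak{S}_{2t}$ on the labels. $G$ and $H$ are homomorphism indistinguishable over $\mathcal{L}_t^+$ if $\hom(F,G)=\hom(F,H)$ for all $\boldsymbol{F} = (F,\boldsymbol{u},\boldsymbol{v})\in\mathcal{L}_t^+$. The logic $\mathsf{M}^t$. An $\mathsf{M}^t$-formula has $2t$ free variables and is of one of the following forms: every quantifier-free first-order formula with equality over the signature $\{E\}$ (edge relation) with $2t$ variables is an $\mathsf{M}^t$-formula; if $\phi,\psi$ are $\mathsf{M}^t$-formulae with the same free variables, then $\neg\phi$, $\phi\land\psi$, $\phi\lor\psi$ are $\mathsf{M}^t$-formulae; if $\phi,\psi$ are $\mathsf{M}^t$-formulae and $n\in\mathbb{N}$, then $\exists^{\geq n}\boldsymbol{y}.(\phi(\boldsymbol{x},\boldsymbol{y})\land\psi(\boldsymbol{y},\boldsymbol{z}))$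 is an $\mathsf{M}^t$-formula, where $\boldsymbol{x},\boldsymbol{y},\boldsymbol{z}$ are pairwise disjoint $t$-tuples of distinct variables. An $\mathsf{M}^t$-sentence is an expression $\exists^{\geq n}\boldsymbol{x}.\ \phi(\boldsymbol{x})$ with $\phi$ an $\mathsf{M}^t$-formula, $\boldsymbol{x}$ a tuple of $2t$ distinct variables, and $n\in\mathbb{N}$. The quantifier $\exists^{\geq n}\boldsymbol{y}.\ \phi(\boldsymbol{y})$ means that at least $n$ many $|\boldsymbol{y}|$-tuples of vertices satisfy $\phi$. -}

module Defs where

open import Data.Bool.Base using (Bool)
open import Data.Fin.Base using (Fin; _↑ˡ_; _↑ʳ_)
open import Data.Fin.Permutation using (Permutation′; _⟨$⟩ʳ_)
open import Data.Fin.Properties using (_≟_; all?)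
open import Data.List.Base as List
  using (List; []; _∷_; cartesianProduct; cartesianProductWith; filter; length)
import Data.List.Relation.Binary.Permutation.Setoid as Multiset
open import Data.Nat.Base using (ℕ; zero; suc; _+_)
open import Data.Product.Base using (∃; ∃₂; _×_; _,_; uncurry)
open import Data.Product.Relation.Binary.Pointwise.NonDependent using (×-setoid)
open import Data.Sum.Base using (_⊎_; inj₁; inj₂)
import Data.Sum.Relation.Binary.Pointwise as Sum
open import Data.Vec.Base
  using (Vec; []; _∷_; _++_; drop; lookup; map; tabulate; take)
open import Data.Vec.Membership.Propositional using (_∈_)
open import Data.Vec.Relation.Unary.All using (All)
open import Data.Vec.Relation.Unary.Unique.Propositional using (Unique)
open import Function.Base using (_∘_)
open import Function.Bundles using (_⇔_)
open import Function.Definitions using (StrictlySurjective)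
open import Level using (0ℓ)
open import Relation.Binary.Bundles using (Setoid)
open import Relation.Binary.Construct.Closure.Equivalence using (EqClosure)
open import Relation.Binary.Core using (Rel)
open import Relation.Binary.Definitions using (Decidable; Symmetric)
open import Relation.Binary.Indexed.Homogeneous.Bundles using (IndexedSetoid)
open import Relation.Binary.PropositionalEquality.Core using (_≡_)
open import Relation.Binary.PropositionalEquality.Properties using (setoid)
open import Relation.Nullary.Decidable.Core using (does; _→-dec_)
open import Relation.Nullary.Negation.Core using (¬_)
import Relation.Unary as Unary

------------------------------------------------------------------------
-- Tuples

permute : ∀ {A : Set} {m} → Permutation′ m → Vec A m → Vec A m
permute σ x = tabulate λ i → lookup x (σ ⟨$⟩ʳ i)

-- Every element of (Fin n)ᵐ, each listed exactly once.
tuples : ∀ n m → List (Vec (Fin n) m)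
tuples n zero    = [] ∷ []
tuples n (suc m) = cartesianProductWith _∷_ (List.allFin n) (tuples n m)

------------------------------------------------------------------------
-- Graphs

-- Loops are allowed.
record Graph : Set₁ where
  field
    order : ℕ
    E     : Rel (Fin order) 0ℓ
    E?    : Decidable E
    E-sym : Symmetric E

  V : Set
  V = Fin order

open Graph public using (V)

Simple : Graph → Set
Simple G = ∀ v → ¬ Graph.E G v v

-- A map V F → V G is represented by its vector of values.
IsHom : ∀ F G → Vec (V G) (Graph.order F) → Set
IsHom F G h = ∀ x y → Graph.E F x y → Graph.E G (lookup h x) (lookup h y)

isHom? : ∀ F G → Unary.Decidable (IsHom F G)
isHom? F G h = all? λ x → all? λ y →
  Graph.E? F x y →-dec Graph.E? G (lookup h x) (lookup h y)

hom : Graph → Graph → ℕ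
hom F G = length (filter (isHom? F G) (tuples (Graph.order G) (Graph.order F)))

------------------------------------------------------------------------
-- Bilabelled graphs

record BilabelledGraph (t : ℕ) : Set₁ where
  constructor bilabelled
  field
    graph : Graph
    ins   : Vec (V graph) t
    outs  : Vec (V graph) t

  labels : Vec (V graph) (t + t)
  labels = ins ++ outs

open BilabelledGraph

Atomic : ∀ {t} → BilabelledGraph t → Set
Atomic F = ∀ v → v ∈ labels F

data Identified {A B : Set} {m} (a : Vec A m) (b : Vec B m) : Rel (A ⊎ B) 0ℓ where
  identified : ∀ i → Identified a b (inj₁ (lookup a i)) (inj₂ (lookup b i))

-- K, with projection p, is the graph obtained from the disjoint union of F and
-- F′ by identifying aᵢ with bᵢ for all i. This determines K up to isomorphism.
-- Edges of K are images of edges, so multiple edges collapse and loops are kept.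
record IsGluing (F F′ K : Graph) {m} (a : Vec (V F) m) (b : Vec (V F′) m)
                (p : V F ⊎ V F′ → V K) : Set where
  field
    surjective : StrictlySurjective _≡_ p
    kernel     : ∀ x y → (p x ≡ p y) ⇔ EqClosure (Identified a b) x y
    edges      : ∀ v w → Graph.E K v w ⇔
                   (∃₂ λ x y → p x ≡ v × p y ≡ w ×
                               Sum.Pointwise (Graph.E F) (Graph.E F′) x y)

IsSeries : ∀ {t} (F F′ K : BilabelledGraph t) → Set
IsSeries F F′ K = ∃ λ p →
  IsGluing (graph F) (graph F′) (graph K) (outs F) (ins F′) p ×
  ins K  ≡ map (p ∘ inj₁) (ins F) ×
  outs K ≡ map (p ∘ inj₂) (outs F′)

IsParallel : ∀ {t} (F F′ K : BilabelledGraph t) → Set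
IsParallel F F′ K = ∃ λ p →
  IsGluing (graph F) (graph F′) (graph K) (labels F) (labels F′) p ×
  ins K  ≡ map (p ∘ inj₁) (ins F) ×
  outs K ≡ map (p ∘ inj₁) (outs F)

permuteLabels : ∀ {t} → Permutation′ (t + t) → BilabelledGraph t → BilabelledGraph t
permuteLabels {t} σ F = bilabelled (graph F) (take t x) (drop t x)
  where x = permute σ (labels F)

-- The class 𝓛ₜ⁺. Compositions are only defined up to isomorphism, so the class
-- contains every representative K.
data 𝓛⁺ (t : ℕ) : BilabelledGraph t → Set₁ where
  atomic   : ∀ {F} → Atomic F → 𝓛⁺ t F
  series   : ∀ {F F′ K} → 𝓛⁺ t F → 𝓛⁺ t F′ → IsSeries F F′ K → 𝓛⁺ t K
  parallel : ∀ {F F′ K} → 𝓛⁺ t F → 𝓛⁺ t F′ → IsParallel F F′ K → 𝓛⁺ t K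
  permuted : ∀ {F} σ → 𝓛⁺ t F → 𝓛⁺ t (permuteLabels σ F)

HomIndistinguishable : ℕ → Graph → Graph → Set₁
HomIndistinguishable t G H =
  ∀ (F : BilabelledGraph t) → 𝓛⁺ t F → hom (graph F) G ≡ hom (graph F) H

------------------------------------------------------------------------
-- The mwl algorithm

-- Families indexed by I, with pointwise equality.
familySetoid : (I : Set) → (I → Setoid 0ℓ 0ℓ) → Setoid 0ℓ 0ℓ
familySetoid I S = IndexedSetoid.setoid record
  { Carrierᵢ       = λ i → Setoid.Carrier (S i)
  ; _≈ᵢ_           = λ {i} → Setoid._≈_ (S i)
  ; isEquivalenceᵢ = record
    { reflᵢ  = λ {i} → Setoid.refl (S i)
    ; symᵢ   = λ {i} → Setoid.sym (S i)
    ; transᵢ = λ {i} → Setoid.trans (S i)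
    }
  }

-- Finite multisets: lists up to reordering.
multisetSetoid : Setoid 0ℓ 0ℓ → Setoid 0ℓ 0ℓ
multisetSetoid S = Multiset.↭-setoid S

-- The (i, j) entry tells whether xᵢ = xⱼ and whether xᵢxⱼ is an edge.
AtomicType : ℕ → Set
AtomicType m = Vec (Vec (Bool × Bool) m) m

atp : ∀ G {m} → Vec (V G) m → AtomicType m
atp G x = tabulate λ i → tabulate λ j →
  does (lookup x i ≟ lookup x j) , does (Graph.E? G (lookup x i) (lookup x j))

module MWL (t : ℕ) where

  -- The range of mwlⁱ⁺¹ᐟ² given that of mwlⁱ.
  Half : Setoid 0ℓ 0ℓ → Setoid 0ℓ 0ℓ
  Half C = familySetoid (Permutation′ (t + t)) λ _ → C

  -- The range of mwlⁱ.
  Colour : ℕ → Setoid 0ℓ 0ℓ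
  Colour zero    = setoid (AtomicType (t + t))
  Colour (suc i) =
    ×-setoid (Half (Colour i))
             (multisetSetoid (×-setoid (Half (Colour i)) (Half (Colour i))))

  -- The range of mwl^∞.
  StableColour : Setoid 0ℓ 0ℓ
  StableColour = familySetoid ℕ Colour

  module _ (G : Graph) where

    mwl  : ∀ i → Vec (V G) (t + t) → Setoid.Carrier (Colour i)

    -- mwl½ i is the colouring mwlⁱ⁺¹ᐟ².
    mwl½ : ∀ i → Vec (V G) (t + t) → Setoid.Carrier (Half (Colour i))

    mwl zero    x = atp G x
    mwl (suc i) x =
      mwl½ i x ,
      List.map (λ y → mwl½ i (take t x ++ y) , mwl½ i (y ++ drop t x))
               (tuples (Graph.order G) t)

    mwl½ i x σ = mwl i (permute σ x)

    mwl∞ : Vec (V G) (t + t) → Setoid.Carrier StableColour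
    mwl∞ x i = mwl i x

    stableColours : List (Setoid.Carrier StableColour)
    stableColours = List.map (mwl∞ ∘ uncurry _++_) (cartesianProduct Vᵗ Vᵗ)
      where Vᵗ = tuples (Graph.order G) t

  NotDistinguished : Graph → Graph → Set
  NotDistinguished G H =
    Setoid._≈_ (multisetSetoid StableColour) (stableColours G) (stableColours H)

------------------------------------------------------------------------
-- The logic

-- First-order formulae over {E} with counting quantifiers over tuples, whose
-- free variables are among k variables. The quantifier ∃≥ n m binds an
-- m-tuple of variables, put in front of the k variables already in scope.
data Formula (k : ℕ) : Set where
  _≐_   : Fin k → Fin k → Formula k
  edge  : Fin k → Fin k → Formula k
  not   : Formula k → Formula k
  _and_ : Formula k → Formula k → Formula k
  _or_  : Formula k → Formula k → Formula k
  ∃≥    : (n m : ℕ) → Formula (m + k) → Formula k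

AtLeast : ℕ → {A : Set} → (A → Set) → Set
AtLeast n {A} P = ∃ λ (ys : Vec A n) → Unique ys × All P ys

-- Satisfaction; the vector assigns a vertex to each variable in scope.
Sat : ∀ G {k} → Formula k → Vec (V G) k → Set
Sat G (i ≐ j)    a = lookup a i ≡ lookup a j
Sat G (edge i j) a = Graph.E G (lookup a i) (lookup a j)
Sat G (not φ)    a = ¬ Sat G φ a
Sat G (φ and ψ)  a = Sat G φ a × Sat G ψ a
Sat G (φ or ψ)   a = Sat G φ a ⊎ Sat G ψ a
Sat G (∃≥ n m φ) a = AtLeast n λ (y : Vec (V G) m) → Sat G φ (y ++ a)

-- Quantifier-free formulae all of whose variables occur in the tuple x.
data QuantifierFree {k m} (x : Vec (Fin k) m) : Formula k → Set where
  _≐_   : ∀ {i j} → i ∈ x → j ∈ x → QuantifierFree x (i ≐ j)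
  edge  : ∀ {i j} → i ∈ x → j ∈ x → QuantifierFree x (edge i j)
  not   : ∀ {φ} → QuantifierFree x φ → QuantifierFree x (not φ)
  _and_ : ∀ {φ ψ} → QuantifierFree x φ → QuantifierFree x ψ → QuantifierFree x (φ and ψ)
  _or_  : ∀ {φ ψ} → QuantifierFree x φ → QuantifierFree x ψ → QuantifierFree x (φ or ψ)

-- Inside ∃≥ n m, the tuple of newly bound variables and a tuple of old ones.
bound : ∀ m k → Vec (Fin (m + k)) m
bound m k = tabulate (_↑ˡ k)

old : ∀ m {k l} → Vec (Fin k) l → Vec (Fin (m + k)) l
old m = map (m ↑ʳ_)

-- MFormula t x φ: φ is an Mᵗ-formula whose 2t free variables are the distinct
-- entries of x. Only the set of these variables matters, so x may be reordered;
-- φ itself is then unchanged.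
data MFormula (t : ℕ) {k} : Vec (Fin k) (t + t) → Formula k → Set where
  quantifierFree : ∀ {x φ} → Unique x → QuantifierFree x φ → MFormula t x φ
  not     : ∀ {x φ} → MFormula t x φ → MFormula t x (not φ)
  _and_   : ∀ {x φ ψ} → MFormula t x φ → MFormula t x ψ → MFormula t x (φ and ψ)
  _or_    : ∀ {x φ ψ} → MFormula t x φ → MFormula t x ψ → MFormula t x (φ or ψ)
  ∃≥      : ∀ n {x z : Vec (Fin k) t} {φ ψ} → Unique (x ++ z) →
            MFormula t (old t x ++ bound t k) φ →
            MFormula t (bound t k ++ old t z) ψ →
            MFormula t (x ++ z) (∃≥ n t (φ and ψ))
  reorder : ∀ {x φ} σ → MFormula t x φ → MFormula t (permute σ x) φ

data MSentence (t : ℕ) : Formula 0 → Set where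
  ∃≥ : ∀ n {φ} → MFormula t (bound (t + t) 0) φ → MSentence t (∃≥ n (t + t) φ)

_⊨_ : Graph → Formula 0 → Set
G ⊨ φ = Sat G φ []

MEquivalent : ℕ → Graph → Graph → Set
MEquivalent t G H = ∀ {φ} → MSentence t φ → (G ⊨ φ) ⇔ (H ⊨ φ)

{-# OPTIONS --safe #-}

-- The labelled homomorphism counts of the graphs in 𝓛ₜ⁺ span an algebra of
-- functions on 2t-tuples, given on G and H simultaneously, which is closed under
-- permuting coordinates and under the composition Σ_y f(x′y) g(yx″). So do the
-- truth values of Mᵗ-formulae, since a number c ≤ N is the sum over 1 ≤ n ≤ N of
-- the truth values of "c ≥ n". In such an algebra, two finite families of points
-- either can be matched so that no function separates matched points, or some
-- function has different sums over them, by polynomial interpolation. Hence the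
-- pairs of tuples that the algebra does not separate form a bisimulation for the
-- mwl algorithm, and if all sums over G and H agree, then the stable colours of G
-- and H can be matched. Conversely, the colour after i rounds determines the
-- labelled homomorphism counts and truth values of construction depth at most i.

module Submission where

open import Defs
open import Data.Nat.Base using (ℕ; _≥_)
open import Data.Product.Base using (_×_)
open import Function.Bundles using (_⇔_)

import Algebra.Properties.AbelianGroup
import Algebra.Properties.CommutativeSemigroup
open import Data.Bool.Base using (Bool; true; false; if_then_else_)
import Data.Bool.Properties as Bool
open import Data.Empty using (⊥)
open import Data.Fin.Base using (Fin; zero; suc; inject≤; join; punchIn; punchOut; splitAt; _↑ˡ_; _↑ʳ_)
open import Data.Fin.Permutation as Perm using (Permutation′; _⟨$⟩ʳ_)
open import Data.Fin.Properties as Fin using (_≟_)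
open import Data.Integer.Base as ℤ using (ℤ; +_; 0ℤ; 1ℤ; _+_; _*_; -_)
import Data.Integer.Properties as ℤ
open import Data.List.Base as List using (List; []; _∷_; cartesianProduct; filter; length)
open import Data.List.Membership.Propositional using () renaming (_∈_ to _∈ˡ_)
import Data.List.Membership.DecPropositional as Dec∈ˡ
import Data.List.Membership.Propositional.Properties as ∈ˡ
import Data.List.Properties as List
open import Data.List.Relation.Binary.Permutation.Homogeneous as Homogeneous using (Permutation)
open import Data.List.Relation.Binary.Permutation.Propositional as ↭ using (_↭_; ↭-refl; ↭-sym; ↭-trans)
import Data.List.Relation.Binary.Permutation.Propositional.Properties as ↭
open import Data.List.Relation.Binary.Pointwise as Pointwise using (Pointwise; []; _∷_)
open import Data.List.Relation.Unary.All as Allˡ using ([]; _∷_)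
import Data.List.Relation.Unary.All.Properties as Allˡ
open import Data.List.Relation.Unary.AllPairs using ([]; _∷_)
open import Data.List.Relation.Unary.Any using (here; there)
import Data.List.Relation.Unary.Unique.Propositional as Uniqueˡ
import Data.List.Relation.Unary.Unique.Propositional.Properties as Uniqueˡ
open import Data.Nat.Base as ℕ using (zero; suc; _≤_; _≤′_; ≤′-refl; ≤′-step; z≤n; s≤s; _⊓_; _⊔_)
import Data.Nat.Properties as ℕ
open import Data.Product.Base using (∃; ∃₂; _,_; map₂; proj₁; proj₂; uncurry)
open import Data.Product.Function.NonDependent.Propositional using (_×-⇔_)
open import Data.Product.Properties using () renaming (≡-dec to ×-≡-dec)
open import Data.Product.Relation.Binary.Pointwise.NonDependent using (×-setoid)
open import Data.Sum.Base as Sum using (_⊎_; inj₁; inj₂; [_,_]′)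
open import Data.Sum.Function.Propositional using (_⊎-⇔_)
open import Data.Sum.Relation.Binary.Pointwise as Sum using (inj₁; inj₂)
open import Data.Vec.Base as Vec
  using (Vec; []; _∷_; allFin; drop; lookup; map; tabulate; take; _++_)
open import Data.Vec.Membership.Propositional using (_∈_)
import Data.Vec.Membership.Propositional.Properties as ∈
import Data.Vec.Properties as Vec
open import Data.Vec.Relation.Unary.All as All using (All; []; _∷_)
import Data.Vec.Relation.Unary.All.Properties as All
open import Data.Vec.Relation.Unary.AllPairs using ([]; _∷_)
import Data.Vec.Relation.Unary.AllPairs.Properties as AllPairs
import Data.Vec.Relation.Unary.Any as Any
import Data.Vec.Relation.Unary.Any.Properties as Any
open import Data.Vec.Relation.Unary.Unique.Propositional using (Unique)
import Data.Vec.Relation.Unary.Unique.Propositional.Properties as Unique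
open import Function.Base using (id; _∘_)
open import Function.Bundles using (Equivalence; mk⇔)
open import Function.Construct.Composition using (_⇔-∘_)
open import Function.Construct.Symmetry using (⇔-sym)
open import Function.Definitions using (StrictlySurjective)
open import Level using (Level; 0ℓ)
open import Relation.Binary.Bundles using (Setoid)
open import Relation.Binary.Construct.Closure.Equivalence as EqClosure using (EqClosure)
open import Relation.Binary.Construct.Closure.ReflexiveTransitive using (ε; _◅_; _◅◅_)
open import Relation.Binary.Construct.Closure.Symmetric using (bwd; fwd)
open import Relation.Binary.Core using (REL; Rel; _⇒_)
open import Relation.Binary.Definitions using (DecidableEquality)
open import Relation.Binary.PropositionalEquality
open import Relation.Nullary.Decidable as Dec
  using (Dec; does; yes; no; dec-false; dec-true; map′; ¬?; _×-dec_; _⊎-dec_)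
open import Relation.Nullary.Negation using (¬_; contradiction)
import Relation.Unary as Unary

open BilabelledGraph
open Algebra.Properties.AbelianGroup ℤ.+-0-abelianGroup using (∙-cancelˡ)
open Algebra.Properties.CommutativeSemigroup ℤ.*-commutativeSemigroup
  using (x∙yz≈y∙xz) renaming (interchange to *-interchange)
open Algebra.Properties.CommutativeSemigroup ℤ.+-commutativeSemigroup
  using () renaming (interchange to +-interchange)

-- Whether the algebra separates two given points is not decided in advance: a separating function
-- may be any member of an infinite family. The relation "not separated" is therefore never formed.
-- Instead, a finite list of candidate pairs is maintained, together with an explicit separating
-- function for every pair outside it. A listed pair that fails one round of the mwl algorithm
-- relative to the list yields such a function and is discarded; as the list shrinks, this stops.
-- The surviving list is a bisimulation and all other pairs are separated, which is exactly what the
-- matching argument consumes. This is why the intermediate results have the form of a disjunction: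
-- either the desired property holds, or here is a separating function.

private variable
  a b r ℓ : Level
  A B : Set a
  P Q : Set ℓ
  X Y : Set

-- Finite sums of integers

∑ : List A → (A → ℤ) → ℤ
∑ []       f = 0ℤ
∑ (x ∷ xs) f = f x + ∑ xs f

∑-cong-∈ : (xs : List A) {f g : A → ℤ} → (∀ {x} → x ∈ˡ xs → f x ≡ g x) → ∑ xs f ≡ ∑ xs g
∑-cong-∈ []       eq = refl
∑-cong-∈ (x ∷ xs) eq = cong₂ _+_ (eq (here refl)) (∑-cong-∈ xs (eq ∘ there))

∑-cong : (xs : List A) {f g : A → ℤ} → (∀ x → f x ≡ g x) → ∑ xs f ≡ ∑ xs g
∑-cong xs eq = ∑-cong-∈ xs λ _ → eq _

∑-zero : (xs : List A) → ∑ xs (λ _ → 0ℤ) ≡ 0ℤ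
∑-zero []       = refl
∑-zero (x ∷ xs) = trans (ℤ.+-identityˡ _) (∑-zero xs)

∑-+ : (xs : List A) (f g : A → ℤ) → ∑ xs (λ x → f x + g x) ≡ ∑ xs f + ∑ xs g
∑-+ []       f g = refl
∑-+ (x ∷ xs) f g = trans (cong (λ h → f x + g x + h) (∑-+ xs f g)) (+-interchange (f x) (g x) _ _)

∑-*ˡ : (xs : List A) (c : ℤ) (f : A → ℤ) → ∑ xs (λ x → c * f x) ≡ c * ∑ xs f
∑-*ˡ []       c f = sym (ℤ.*-zeroʳ c)
∑-*ˡ (x ∷ xs) c f = trans (cong (λ h → c * f x + h) (∑-*ˡ xs c f)) (sym (ℤ.*-distribˡ-+ c (f x) _))

∑-*ʳ : (xs : List A) (c : ℤ) (f : A → ℤ) → ∑ xs (λ x → f x * c) ≡ ∑ xs f * c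
∑-*ʳ xs c f = trans (∑-cong xs λ x → ℤ.*-comm (f x) c) (trans (∑-*ˡ xs c f) (ℤ.*-comm c _))

∑-swap : (xs : List A) (ys : List B) (f : A → B → ℤ) →
         ∑ xs (λ x → ∑ ys (f x)) ≡ ∑ ys (λ y → ∑ xs (λ x → f x y))
∑-swap []       ys f = sym (∑-zero ys)
∑-swap (x ∷ xs) ys f = trans (cong (λ h → ∑ ys (f x) + h) (∑-swap xs ys f)) (sym (∑-+ ys (f x) _))

∑-++ : (xs ys : List A) (f : A → ℤ) → ∑ (xs List.++ ys) f ≡ ∑ xs f + ∑ ys f
∑-++ []       ys f = sym (ℤ.+-identityˡ _)
∑-++ (x ∷ xs) ys f = trans (cong (λ h → f x + h) (∑-++ xs ys f)) (sym (ℤ.+-assoc (f x) _ _))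

∑-map : (g : A → B) (xs : List A) (f : B → ℤ) → ∑ (List.map g xs) f ≡ ∑ xs (f ∘ g)
∑-map g []       f = refl
∑-map g (x ∷ xs) f = cong (λ h → f (g x) + h) (∑-map g xs f)

∑-cartesianProduct : (xs : List A) (ys : List B) (f : A × B → ℤ) →
  ∑ (cartesianProduct xs ys) f ≡ ∑ xs (λ x → ∑ ys (λ y → f (x , y)))
∑-cartesianProduct []       ys f = refl
∑-cartesianProduct (x ∷ xs) ys f = trans (∑-++ (List.map (x ,_) ys) _ f)
  (cong₂ _+_ (∑-map (x ,_) ys f) (∑-cartesianProduct xs ys f))

∑-× : (xs : List A) (ys : List B) (f : A → ℤ) (g : B → ℤ) →
      ∑ xs f * ∑ ys g ≡ ∑ (cartesianProduct xs ys) λ (x , y) → f x * g y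
∑-× xs ys f g = begin
  ∑ xs f * ∑ ys g                       ≡⟨ ∑-*ʳ xs (∑ ys g) f ⟨
  ∑ xs (λ x → f x * ∑ ys g)             ≡⟨ ∑-cong xs (λ x → sym (∑-*ˡ ys (f x) g)) ⟩
  ∑ xs (λ x → ∑ ys (λ y → f x * g y))   ≡⟨ ∑-cartesianProduct xs ys _ ⟨
  ∑ (cartesianProduct xs ys) _          ∎
  where open ≡-Reasoning

∑-↭ : {xs ys : List A} (f : A → ℤ) → xs ↭ ys → ∑ xs f ≡ ∑ ys f
∑-↭ f ↭.refl = refl
∑-↭ f (↭.prep x p) = cong (λ h → f x + h) (∑-↭ f p)
∑-↭ f (↭.swap {xs} {ys} x y p) = begin
  f x + (f y + ∑ xs f) ≡⟨ ℤ.+-assoc (f x) (f y) _ ⟨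
  f x + f y + ∑ xs f   ≡⟨ cong₂ _+_ (ℤ.+-comm (f x) (f y)) (∑-↭ f p) ⟩
  f y + f x + ∑ ys f   ≡⟨ ℤ.+-assoc (f y) (f x) _ ⟩
  f y + (f x + ∑ ys f) ∎
  where open ≡-Reasoning
∑-↭ f (↭.trans p q) = trans (∑-↭ f p) (∑-↭ f q)

-- Indicators and counting

𝟙 : Dec P → ℤ
𝟙 d = if does d then 1ℤ else 0ℤ

𝟙-yes : (d : Dec P) → P → 𝟙 d ≡ 1ℤ
𝟙-yes d p = cong (λ b → if b then 1ℤ else 0ℤ) (dec-true d p)

𝟙-no : (d : Dec P) → ¬ P → 𝟙 d ≡ 0ℤ
𝟙-no d ¬p = cong (λ b → if b then 1ℤ else 0ℤ) (dec-false d ¬p)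

𝟙-cong : (p : Dec P) (q : Dec Q) → (P → Q) → (Q → P) → 𝟙 p ≡ 𝟙 q
𝟙-cong (yes p) q f g = sym (𝟙-yes q (f p))
𝟙-cong (no ¬p) q f g = sym (𝟙-no q (¬p ∘ g))

𝟙-injective : (p : Dec P) (q : Dec Q) → 𝟙 p ≡ 𝟙 q → does p ≡ does q
𝟙-injective (yes _) (yes _) _ = refl
𝟙-injective (no _)  (no _)  _ = refl

𝟙-× : (p : Dec P) (q : Dec Q) → 𝟙 (p ×-dec q) ≡ 𝟙 p * 𝟙 q
𝟙-× (yes p) q = sym (ℤ.*-identityˡ (𝟙 q))
𝟙-× (no ¬p) q = refl

length-filter : {P : A → Set ℓ} (P? : Unary.Decidable P) (xs : List A) →
                + length (filter P? xs) ≡ ∑ xs (λ x → 𝟙 (P? x))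
length-filter P? [] = refl
length-filter P? (x ∷ xs) with P? x
... | yes _ = cong (λ h → 1ℤ + h) (length-filter P? xs)
... | no  _ = trans (length-filter P? xs) (sym (ℤ.+-identityˡ _))

IsEnumeration : List A → Set _
IsEnumeration xs = Uniqueˡ.Unique xs × (∀ x → x ∈ˡ xs)

-- `P` holds at most at `c`, so only the term at `c` can survive. Whether it does is left to the
-- right-hand side, so that the same statement covers conditions that fail everywhere.
∑-δ : {xs : List A} → IsEnumeration xs → {P : A → Set ℓ} (P? : Unary.Decidable P) (c : A) →
      (∀ {x} → P x → x ≡ c) → ∑ xs (λ x → 𝟙 (P? x)) ≡ 𝟙 (P? c)
∑-δ (unique , complete) P? c only = δ unique (complete c)
  where
  δ : ∀ {xs} → Uniqueˡ.Unique xs → c ∈ˡ xs → ∑ xs (λ x → 𝟙 (P? x)) ≡ 𝟙 (P? c)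
  δ {_ ∷ xs} (≢xs ∷ u) (here refl) =
    trans (cong (λ h → 𝟙 (P? c) + h) (trans
      (∑-cong-∈ xs λ x∈ → 𝟙-no (P? _) λ p → Allˡ.lookup ≢xs x∈ (sym (only p)))
      (∑-zero xs)))
    (ℤ.+-identityʳ _)
  δ (≢xs ∷ u) (there c∈) =
    trans (cong₂ _+_ (𝟙-no (P? _) λ p → Allˡ.lookup ≢xs c∈ (only p)) (δ u c∈)) (ℤ.+-identityˡ _)

-- Double counting: both sides equal the sum over all pairs (x , y) in the common graph of `φ` and
-- `ψ`. The maps are total but need to be mutually inverse only where `P` and `Q` hold.
∑-bijection :
  {xs : List A} {ys : List B} → IsEnumeration xs → IsEnumeration ys →
  DecidableEquality A → DecidableEquality B →
  {P : A → Set ℓ} {Q : B → Set ℓ} (P? : Unary.Decidable P) (Q? : Unary.Decidable Q)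
  (φ : A → B) (ψ : B → A) →
  (∀ {x} → P x → Q (φ x)) → (∀ {y} → Q y → P (ψ y)) →
  (∀ {x} → P x → ψ (φ x) ≡ x) → (∀ {y} → Q y → φ (ψ y) ≡ y) →
  ∑ xs (λ x → 𝟙 (P? x)) ≡ ∑ ys (λ y → 𝟙 (Q? y))
∑-bijection {xs = xs} {ys} enumA enumB _≟A_ _≟B_ {P} {Q} P? Q? φ ψ φ-Q ψ-P ψφ φψ = begin
  ∑ xs (λ x → 𝟙 (P? x))
    ≡⟨ ∑-cong xs (λ x → trans (𝟙-cong (P? x) (P? x ×-dec φ x ≟B φ x) (_, refl) proj₁)
         (sym (∑-δ enumB (λ y → P? x ×-dec y ≟B φ x) (φ x) proj₂))) ⟩
  ∑ xs (λ x → ∑ ys (λ y → 𝟙 (P? x ×-dec y ≟B φ x)))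
    ≡⟨ ∑-swap xs ys _ ⟩
  ∑ ys (λ y → ∑ xs (λ x → 𝟙 (P? x ×-dec y ≟B φ x)))
    ≡⟨ ∑-cong ys (λ y → ∑-cong xs λ x → 𝟙-cong (P? x ×-dec y ≟B φ x) (Q? y ×-dec x ≟A ψ y)
         (λ (p , e) → subst Q (sym e) (φ-Q p) , trans (sym (ψφ p)) (cong ψ (sym e)))
         (λ (q , e) → subst P (sym e) (ψ-P q) , trans (sym (φψ q)) (cong φ (sym e)))) ⟩
  ∑ ys (λ y → ∑ xs (λ x → 𝟙 (Q? y ×-dec x ≟A ψ y)))
    ≡⟨ ∑-cong ys (λ y → trans (∑-δ enumA (λ x → Q? y ×-dec x ≟A ψ y) (ψ y) proj₂)
         (𝟙-cong (Q? y ×-dec ψ y ≟A ψ y) (Q? y) proj₁ (_, refl))) ⟩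
  ∑ ys (λ y → 𝟙 (Q? y)) ∎
  where open ≡-Reasoning

tuples-enumeration : ∀ n m → IsEnumeration (tuples n m)
tuples-enumeration n zero    = [] ∷ [] , λ { [] → here refl }
tuples-enumeration n (suc m) with u , c ← tuples-enumeration n m =
  Uniqueˡ.cartesianProductWith⁺ _∷_ Vec.∷-injective (Uniqueˡ.allFin⁺ n) u ,
  λ { (x ∷ xs) → ∈ˡ.∈-cartesianProductWith⁺ _∷_ (∈ˡ.∈-allFin x) (c xs) }

×-enumeration : {xs : List A} {ys : List B} →
  IsEnumeration xs → IsEnumeration ys → IsEnumeration (cartesianProduct xs ys)
×-enumeration (u , c) (u′ , c′) =
  Uniqueˡ.cartesianProduct⁺ u u′ , λ (x , y) → ∈ˡ.∈-cartesianProduct⁺ (c x) (c′ y)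

_≟ᵛ_ : ∀ {n m} → DecidableEquality (Vec (Fin n) m)
_≟ᵛ_ = Vec.≡-dec _≟_

-- Matchings

-- A bijection between the positions of the two lists along which `R` holds. The types may differ,
-- since points of G are to be matched with points of H.
Match : {A : Set a} {B : Set b} → REL A B ℓ → List A → List B → Set _
Match R xs ys = ∃ λ zs → Pointwise R xs zs × zs ↭ ys

Match-map : {R S : REL A B ℓ} → (∀ {x y} → R x y → S x y) → ∀ {xs ys} → Match R xs ys → Match S xs ys
Match-map f (zs , pw , p) = zs , Pointwise.map f pw , p

∑-Match : {R : REL A B ℓ} {f : A → ℤ} {g : B → ℤ} → (∀ {x y} → R x y → f x ≡ g y) →
          ∀ {xs ys} → Match R xs ys → ∑ xs f ≡ ∑ ys g
∑-Match {R = R} {f} {g} eq (zs , pw , p) = trans (go pw) (∑-↭ g p)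
  where
  go : ∀ {xs zs} → Pointwise R xs zs → ∑ xs f ≡ ∑ zs g
  go []       = refl
  go (r ∷ rs) = cong₂ _+_ (eq r) (go rs)

module _ {A : Set a} (_≟_ : DecidableEquality A) where

  multiplicity : A → List A → ℤ
  multiplicity c xs = ∑ xs λ x → 𝟙 (x ≟ c)

  multiplicity-head : ∀ c xs → multiplicity c (c ∷ xs) ≢ 0ℤ
  -- The head contributes 1 and the tail a length, so the sum computes to a successor.
  multiplicity-head c xs eq with () ← trans
    (sym (cong₂ _+_ (𝟙-yes (c ≟ c) refl) (sym (length-filter (_≟ c) xs)))) eq

  -- The elements of `xs` are cancelled one by one against occurrences in `ys`. An element that
  -- cannot be cancelled has different multiplicities in what remains, and restoring the cancelled
  -- pairs adds the same amount to both sides.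
  ↭-or-multiplicity : ∀ xs ys → xs ↭ ys ⊎ ∃ λ c → multiplicity c xs ≢ multiplicity c ys
  ↭-or-multiplicity []       []       = inj₁ ↭-refl
  ↭-or-multiplicity []       (y ∷ ys) = inj₂ (y , multiplicity-head y ys ∘ sym)
  ↭-or-multiplicity (x ∷ xs) ys with Dec∈ˡ._∈?_ _≟_ x ys
  ... | no x∉ = inj₂ (x , λ eq → multiplicity-head x xs (trans eq (trans
          (∑-cong-∈ ys λ {y} y∈ → 𝟙-no (y ≟ x) λ { refl → x∉ y∈ }) (∑-zero ys))))
  ... | yes x∈ with ys₁ , ys₂ , refl ← ∈ˡ.∈-∃++ x∈ with ↭-or-multiplicity xs (ys₁ List.++ ys₂)
  ...   | inj₁ p       = inj₁ (↭-trans (↭.prep x p) (↭-sym (↭.shift x ys₁ ys₂)))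
  ...   | inj₂ (c , ≢) = inj₂ (c , λ eq → ≢ (∙-cancelˡ (𝟙 (x ≟ c)) _ _ (trans eq (∑-↭ _ (↭.shift x ys₁ ys₂)))))

-- Interpolation without division: poly c vs vanishes on vs except at c.
factor : ∀ {c v : ℤ} → Dec (v ≡ c) → ℤ → ℤ
factor         (yes _) z = 1ℤ
factor {v = v} (no  _) z = z + - v

factor≢0 : ∀ {c v} (d : Dec (v ≡ c)) → factor d c ≢ 0ℤ
factor≢0         (no v≢c) eq = v≢c (sym (ℤ.i-j≡0⇒i≡j _ _ eq))

factor≡0 : ∀ {c v} (d : Dec (v ≡ c)) → v ≢ c → factor d v ≡ 0ℤ
factor≡0         (yes v≡c) v≢c = contradiction v≡c v≢c
factor≡0 {v = v} (no _)    v≢c = ℤ.+-inverseʳ v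

poly : ℤ → List ℤ → ℤ → ℤ
poly c []       z = 1ℤ
poly c (v ∷ vs) z = factor (v ℤ.≟ c) z * poly c vs z

*≢0 : ∀ {i j} → i ≢ 0ℤ → j ≢ 0ℤ → i * j ≢ 0ℤ
*≢0 {i} i≢0 j≢0 eq = [ i≢0 , j≢0 ]′ (ℤ.i*j≡0⇒i≡0∨j≡0 i eq)

poly≢0 : ∀ c vs → poly c vs c ≢ 0ℤ
poly≢0 c []       ()
poly≢0 c (v ∷ vs) = *≢0 (factor≢0 (v ℤ.≟ c)) (poly≢0 c vs)

poly≡0 : ∀ c {vs v} → v ∈ˡ vs → v ≢ c → poly c vs v ≡ 0ℤ
poly≡0 c {v ∷ vs} (here refl) v≢c = cong (_* poly c vs v) (factor≡0 (v ℤ.≟ c) v≢c)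
poly≡0 c {w ∷ vs} {v} (there v∈) v≢c =
  trans (cong (factor (w ℤ.≟ c) v *_) (poly≡0 c v∈ v≢c)) (ℤ.*-zeroʳ (factor (w ℤ.≟ c) v))

-- Separating two finite families of points by an algebra of functions

-- Indexing by Bool lets functions be given on the tuples of G and H simultaneously.
Fn : (Bool → Set) → Set
Fn P = ∀ s → P s → ℤ

record IsAlgebra {P : Bool → Set} (T : Fn P → Set ℓ) : Set ℓ where
  field
    const : ∀ c → T λ _ _ → c
    add   : ∀ {f g} → T f → T g → T λ s p → f s p + g s p
    mul   : ∀ {f g} → T f → T g → T λ s p → f s p * g s p

Separated : {P : Bool → Set} → (Fn P → Set ℓ) → P true → P false → Set ℓ
Separated T x y = ∃ λ f → T f × f true x ≢ f false y

module Separation {P : Bool → Set} {T : Fn P → Set ℓ} (algebra : IsAlgebra T)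
                  (l : ∀ s → List (P s)) where
  open IsAlgebra algebra

  -- Indicator functions are only available up to a factor, for lack of division.
  Indicator : (Q : ∀ s → P s → Set) → (∀ s p → Dec (Q s p)) → Set ℓ
  Indicator Q Q? = ∃₂ λ g k → T g × k ≢ 0ℤ × ∀ s {p} → p ∈ˡ l s → g s p ≡ k * 𝟙 (Q? s p)

  -- Here `vs` lists the values of `f` on both families, so `poly c vs` composed with `f` vanishes
  -- at every listed point whose value is not `c`. The factor is the value of the polynomial at `c`.
  value-indicator : ∀ {f} → T f → ∀ c → Indicator (λ s p → f s p ≡ c) (λ s p → f s p ℤ.≟ c)
  value-indicator {f} Tf c = (λ s p → poly c vs (f s p)) , poly c vs c , poly-T vs , poly≢0 c vs , eq
    where
    vs : List ℤ
    vs = List.map (f true) (l true) List.++ List.map (f false) (l false)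

    factor-T : ∀ {v} (d : Dec (v ≡ c)) → T λ s p → factor d (f s p)
    factor-T         (yes _) = const 1ℤ
    factor-T {v = v} (no  _) = add Tf (const (- v))

    poly-T : ∀ vs → T λ s p → poly c vs (f s p)
    poly-T []       = const 1ℤ
    poly-T (v ∷ vs) = mul (factor-T (v ℤ.≟ c)) (poly-T vs)

    f∈vs : ∀ s {p} → p ∈ˡ l s → f s p ∈ˡ vs
    f∈vs true  p∈ = ∈ˡ.∈-++⁺ˡ (∈ˡ.∈-map⁺ (f true) p∈)
    f∈vs false p∈ = ∈ˡ.∈-++⁺ʳ _ (∈ˡ.∈-map⁺ (f false) p∈)

    eq : ∀ s {p} → p ∈ˡ l s → poly c vs (f s p) ≡ poly c vs c * 𝟙 (f s p ℤ.≟ c)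
    eq s {p} p∈ with f s p ℤ.≟ c
    ... | yes fp≡c = trans (cong (poly c vs) fp≡c) (sym (ℤ.*-identityʳ _))
    ... | no  fp≢c = trans (poly≡0 c (f∈vs s p∈) fp≢c) (sym (ℤ.*-zeroʳ (poly c vs c)))

  Tests : Set ℓ
  Tests = List (∃ T)

  profile : Tests → ∀ s → P s → List ℤ
  profile fs s p = List.map (λ f → proj₁ f s p) fs

  profile-indicator : ∀ fs c →
    Indicator (λ s p → profile fs s p ≡ c) (λ s p → List.≡-dec ℤ._≟_ (profile fs s p) c)
  profile-indicator []       []      = _ , 1ℤ , const 1ℤ , (λ ()) , λ _ _ → refl
  -- A list of the wrong length is nobody's profile, so the zero function is its indicator, with 1
  -- as an arbitrary nonzero factor.
  profile-indicator []       (_ ∷ _) = _ , 1ℤ , const 0ℤ , (λ ()) , λ _ _ → refl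
  profile-indicator (_ ∷ _)  []      = _ , 1ℤ , const 0ℤ , (λ ()) , λ _ _ → refl
  profile-indicator ((f , Tf) ∷ fs) (c ∷ cs)
    with g , k , Tg , k≢0 , eq ← value-indicator Tf c
    with g′ , k′ , Tg′ , k′≢0 , eq′ ← profile-indicator fs cs =
    _ , k * k′ , mul Tg Tg′ , *≢0 k≢0 k′≢0 , λ s {p} p∈ → begin
      g s p * g′ s p                    ≡⟨ cong₂ _*_ (eq s p∈) (eq′ s p∈) ⟩
      (k * 𝟙 (f? s p)) * (k′ * 𝟙 (fs? s p)) ≡⟨ *-interchange k _ k′ _ ⟩
      (k * k′) * (𝟙 (f? s p) * 𝟙 (fs? s p)) ≡⟨ cong (k * k′ *_) (sym (𝟙-× (f? s p) (fs? s p))) ⟩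
      (k * k′) * 𝟙 (f? s p ×-dec fs? s p)   ≡⟨ cong (k * k′ *_) (𝟙-cong (f? s p ×-dec fs? s p)
          (List.≡-dec ℤ._≟_ _ _) (uncurry (cong₂ _∷_)) List.∷-injective) ⟩
      (k * k′) * 𝟙 (List.≡-dec ℤ._≟_ (profile ((f , Tf) ∷ fs) s p) (c ∷ cs)) ∎
    where
    open ≡-Reasoning
    f? : ∀ s p → Dec (f s p ≡ c)
    f? s p = f s p ℤ.≟ c
    fs? : ∀ s p → Dec (profile fs s p ≡ cs)
    fs? s p = List.≡-dec ℤ._≟_ (profile fs s p) cs

  module _ {R : P true → P false → Set r} (R-or-separated : ∀ x y → R x y ⊎ Separated T x y) where

    Agree : P true → P false → Tests → Set ℓ
    Agree x y = Allˡ.All λ (f , Tf) → f true x ≡ f false y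

    -- One test for each separated pair of listed points is enough. Agreement on all of them leaves
    -- only the pairs for which `R` was supplied.
    separating-tests : ∀ xs ys → ∃ λ fs → ∀ {x y} → x ∈ˡ xs → y ∈ˡ ys → Agree x y fs → R x y
    separating-tests []       ys = [] , λ ()
    separating-tests (x ∷ xs) ys =
      let fs  , ok  = row ys
          fs′ , ok′ = separating-tests xs ys
      in fs List.++ fs′ , λ where
        (here refl) y∈ agree → ok y∈ (Allˡ.++⁻ˡ fs agree)
        (there x∈)  y∈ agree → ok′ x∈ y∈ (Allˡ.++⁻ʳ fs agree)
      where
      row : ∀ ys → ∃ λ fs → ∀ {y} → y ∈ˡ ys → Agree x y fs → R x y
      row []       = [] , λ ()
      row (y ∷ ys) with R-or-separated x y | row ys
      ... | inj₁ r | fs , ok = fs , λ { (here refl) _ → r ; (there y∈) agree → ok y∈ agree }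
      ... | inj₂ (f , Tf , ≢) | fs , ok = (f , Tf) ∷ fs , λ where
        (here refl) (eq ∷ _)    → contradiction eq ≢
        (there y∈)  (_ ∷ agree) → ok y∈ agree

    -- Points are compared through their profiles under finitely many tests. If the two multisets of
    -- profiles coincide, points with equal profiles can be matched. Otherwise some profile `c`
    -- occurs with different multiplicities; the sums of its scaled indicator are `k` times these
    -- multiplicities, and `k` cancels.
    match-or-unbalanced : Match R (l true) (l false) ⊎
                          ∃ λ f → T f × ∑ (l true) (f true) ≢ ∑ (l false) (f false)
    match-or-unbalanced with fs , sep ← separating-tests (l true) (l false)
      with ↭-or-multiplicity (List.≡-dec ℤ._≟_)
             (List.map (profile fs true) (l true)) (List.map (profile fs false) (l false))
    ... | inj₁ p with zs , eq , lf↭zs ← ↭.↭-map-inv (profile fs false) (↭-sym p) =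
      inj₁ (zs , pointwise (l true) zs id (↭.∈-resp-↭ (↭-sym lf↭zs)) eq , ↭-sym lf↭zs)
      where
      agree : ∀ {x y} fs → profile fs true x ≡ profile fs false y → Agree x y fs
      agree []       eq = []
      agree (f ∷ fs) eq = let e , es = List.∷-injective eq in e ∷ agree fs es

      pointwise : ∀ xs zs → (∀ {x} → x ∈ˡ xs → x ∈ˡ l true) → (∀ {z} → z ∈ˡ zs → z ∈ˡ l false) →
                  List.map (profile fs true) xs ≡ List.map (profile fs false) zs → Pointwise R xs zs
      pointwise []       []       _ _ _  = []
      pointwise (x ∷ xs) (z ∷ zs) h k eq =
        let e , es = List.∷-injective eq
        in sep (h (here refl)) (k (here refl)) (agree fs e)
           ∷ pointwise xs zs (h ∘ there) (k ∘ there) es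
    ... | inj₂ (c , ≢) with g , k , Tg , k≢0 , eq ← profile-indicator fs c =
      inj₂ (g , Tg , λ balanced → ≢ (ℤ.*-cancelˡ-≡ k _ _ {{ℤ.≢-nonZero k≢0}}
        (trans (sym (count true)) (trans balanced (count false)))))
      where
      count : ∀ s → ∑ (l s) (g s) ≡ k * multiplicity (List.≡-dec ℤ._≟_) c (List.map (profile fs s) (l s))
      count s = begin
        ∑ (l s) (g s) ≡⟨ ∑-cong-∈ (l s) (eq s) ⟩
        ∑ (l s) (λ p → k * 𝟙 (List.≡-dec ℤ._≟_ (profile fs s p) c)) ≡⟨ ∑-*ˡ (l s) k _ ⟩
        k * ∑ (l s) (λ p → 𝟙 (List.≡-dec ℤ._≟_ (profile fs s p) c)) ≡⟨ cong (k *_) (∑-map (profile fs s) (l s) _) ⟨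
        k * multiplicity (List.≡-dec ℤ._≟_) c (List.map (profile fs s) (l s)) ∎
        where open ≡-Reasoning

-- Exhaustive search and refinement of finite lists

all-or-Fin : ∀ {n} {P : Fin n → Set a} {Q : Set b} → (∀ i → P i ⊎ Q) → (∀ i → P i) ⊎ Q
all-or-Fin {n = zero}  f = inj₁ λ ()
all-or-Fin {n = suc n} f with f zero | all-or-Fin (f ∘ suc)
... | inj₂ q | _      = inj₂ q
... | inj₁ _ | inj₂ q = inj₂ q
... | inj₁ p | inj₁ g = inj₁ λ { zero → p ; (suc i) → g i }

-- A permutation is determined by the image of `zero` and a permutation of the remaining elements,
-- which reduces the search to finitely many cases. Reassembling it gives only a pointwise equal
-- permutation, hence the assumption that `P` respects `Perm.≈`.
all-or-Perm : ∀ n {P : Permutation′ n → Set a} {Q : Set b} → (∀ {π ρ} → π Perm.≈ ρ → P π → P ρ) →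
              (∀ π → P π ⊎ Q) → (∀ π → P π) ⊎ Q
all-or-Perm zero    resp f = [ (λ p → inj₁ λ π → resp (λ ()) p) , inj₂ ]′ (f Perm.id)
all-or-Perm (suc n) {P} resp f =
  [ (λ g → inj₁ λ π → resp (Perm.insert-remove zero π) (g (π ⟨$⟩ʳ zero) (Perm.remove zero π)))
  , inj₂ ]′
  (all-or-Fin λ j → all-or-Perm n {λ π → P (Perm.insert zero j π)} (resp ∘ insert-cong j) λ π → f _)
  where
  insert-cong : ∀ {n} j {π ρ : Permutation′ n} → π Perm.≈ ρ → Perm.insert zero j π Perm.≈ Perm.insert zero j ρ
  insert-cong j eq zero    = refl
  insert-cong j eq (suc k) = cong (punchIn j) (eq k)

all-or-some : {P : A → Set b} {Q : A → Set ℓ} → (∀ x → P x ⊎ Q x) → ∀ xs →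
              (∀ {x} → x ∈ˡ xs → P x) ⊎ ∃₂ λ ys zs → ∃ λ x → xs ≡ ys List.++ x ∷ zs × Q x
all-or-some f [] = inj₁ λ ()
all-or-some f (x ∷ xs) with f x | all-or-some f xs
... | inj₂ q | _ = inj₂ ([] , xs , x , refl , q)
... | inj₁ _ | inj₂ (ys , zs , y , refl , q) = inj₂ (x ∷ ys , zs , y , refl , q)
... | inj₁ p | inj₁ g = inj₁ λ { (here refl) → p ; (there x∈) → g x∈ }

-- Colour refinement: discard separated elements until every remaining one is OK.
refine : {Sep : A → Set ℓ} {OK : List A → A → Set b} →
         (∀ L → (∀ x → x ∈ˡ L ⊎ Sep x) → ∀ x → OK L x ⊎ Sep x) →
         ∀ L → (∀ x → x ∈ˡ L ⊎ Sep x) →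
         ∃ λ L → (∀ x → x ∈ˡ L ⊎ Sep x) × (∀ x → x ∈ˡ L → OK L x)
refine {A = A} {Sep = Sep} {OK} step L inv = go (length L) L refl inv
  where
  go : ∀ n L → length L ≡ n → (∀ x → x ∈ˡ L ⊎ Sep x) →
       ∃ λ L → (∀ x → x ∈ˡ L ⊎ Sep x) × (∀ x → x ∈ˡ L → OK L x)
  go n L eq inv with all-or-some (step L inv) L
  ... | inj₁ ok = L , inv , λ _ → ok
  go zero .(ys List.++ y ∷ zs) eq inv | inj₂ (ys , zs , y , refl , q)
    with () ← trans (sym (↭.↭-length (↭.shift y ys zs))) eq
  go (suc n) .(ys List.++ y ∷ zs) eq inv | inj₂ (ys , zs , y , refl , q) =
    go n (ys List.++ zs) (ℕ.suc-injective (trans (sym (↭.↭-length (↭.shift y ys zs))) eq)) inv′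
    where
    inv′ : ∀ x → x ∈ˡ (ys List.++ zs) ⊎ Sep x
    inv′ x with inv x
    ... | inj₂ s = inj₂ s
    ... | inj₁ x∈ with ↭.∈-resp-↭ (↭.shift y ys zs) x∈
    ...   | here refl = inj₂ q
    ...   | there x∈′ = inj₁ x∈′

-- Matchings and equality of multisets of colours

module _ {S : Setoid a ℓ} where
  open Setoid S using (_≈_; Carrier) renaming (refl to ≈-refl)

  map-↭ : (g : B → Carrier) → ∀ {xs ys} → xs ↭ ys → Permutation _≈_ (List.map g xs) (List.map g ys)
  map-↭ g ↭.refl         = Homogeneous.refl (Pointwise.refl ≈-refl)
  map-↭ g (↭.prep x p)   = Homogeneous.prep ≈-refl (map-↭ g p)
  map-↭ g (↭.swap x y p) = Homogeneous.swap ≈-refl ≈-refl (map-↭ g p)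
  map-↭ g (↭.trans p q)  = Homogeneous.trans (map-↭ g p) (map-↭ g q)

  Match⇒↭ : {f : A → Carrier} {g : B → Carrier} → ∀ {xs ys} →
            Match (λ x y → f x ≈ g y) xs ys → Permutation _≈_ (List.map f xs) (List.map g ys)
  Match⇒↭ {f = f} {g} (zs , pw , p) = Homogeneous.trans (Homogeneous.refl (Pointwise.map⁺ f g pw)) (map-↭ g p)

  -- A setoid permutation may replace colours by equal ones at every stage. The recursion collects
  -- all these replacements into one pointwise relation and leaves a plain reordering of `ys`.
  ↭⇒Match : {f : A → Carrier} {g : B → Carrier} → ∀ {xs ys} →
            Permutation _≈_ (List.map f xs) (List.map g ys) → Match (λ x y → f x ≈ g y) xs ys
  ↭⇒Match {f = f} {g} {xs} {ys} p = let zs , pw , q = go p (reflexive ys) in zs , unmap xs pw , q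
    where
    ≈-trans = Setoid.trans S

    reflexive : ∀ ys → Pointwise (λ b y → b ≈ g y) (List.map g ys) ys
    reflexive []       = []
    reflexive (y ∷ ys) = ≈-refl ∷ reflexive ys

    unmap : ∀ xs {zs} → Pointwise (λ b z → b ≈ g z) (List.map f xs) zs → Pointwise (λ x z → f x ≈ g z) xs zs
    unmap []       []       = []
    unmap (x ∷ xs) (e ∷ es) = e ∷ unmap xs es

    go : ∀ {as bs ys} → Permutation _≈_ as bs → Pointwise (λ b y → b ≈ g y) bs ys →
         Match (λ a y → a ≈ g y) as ys
    go (Homogeneous.refl as≈bs) bs≈ys = _ , Pointwise.transitive ≈-trans as≈bs bs≈ys , ↭.refl
    go (Homogeneous.prep e p) (e′ ∷ bs≈ys) with zs , pw , q ← go p bs≈ys = _ , ≈-trans e e′ ∷ pw , ↭.prep _ q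
    go (Homogeneous.swap e₁ e₂ p) (e₁′ ∷ e₂′ ∷ bs≈ys) with zs , pw , q ← go p bs≈ys =
      _ , ≈-trans e₁ e₂′ ∷ ≈-trans e₂ e₁′ ∷ pw , ↭.swap _ _ q
    go (Homogeneous.trans p q) bs≈ys with zs , pw , r ← go q bs≈ys with zs′ , pw′ , r′ ← go p pw =
      zs′ , pw′ , ↭.trans r′ r

-- Coherent algebras of functions and the mwl algorithm

module _ (t : ℕ) (𝔾 : Bool → Graph) where
  open MWL t

  Point : Bool → Set
  Point s = Vec (V (𝔾 s)) (t ℕ.+ t)

  allTuples : ∀ s → List (Vec (V (𝔾 s)) t)
  allTuples s = tuples (Graph.order (𝔾 s)) t

  allPairs : ∀ s → List (Point s)
  allPairs s = List.map (uncurry _++_) (cartesianProduct (allTuples s) (allTuples s))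

  -- The matrix product, a function on 2t-tuples being read as a matrix whose rows and columns are
  -- indexed by t-tuples.
  _∙_ : Fn Point → Fn Point → Fn Point
  (f ∙ g) s x = ∑ (allTuples s) λ y → f s (take t x ++ y) * g s (y ++ drop t x)

  -- An analogue of a coherent algebra, closed under both the entrywise and the matrix product. The
  -- fields `equal` and `adjacent` let it detect atomic types, while `perm` and `compose` mirror the
  -- two halves of a round.
  record IsCoherent (T : Fn Point → Set ℓ) : Set ℓ where
    field
      isAlgebra : IsAlgebra T
      ext       : ∀ {f g} → (∀ s x → f s x ≡ g s x) → T f → T g
      equal     : ∀ i j → T λ s x → 𝟙 (lookup x i ≟ lookup x j)
      adjacent  : ∀ i j → T λ s x → 𝟙 (Graph.E? (𝔾 s) (lookup x i) (lookup x j))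
      perm      : ∀ σ {f} → T f → T λ s x → f s (permute σ x)
      compose   : ∀ {f g} → T f → T g → T (f ∙ g)

  module _ {T : Fn Point → Set ℓ} (coherent : IsCoherent T) where
    open IsCoherent coherent
    open IsAlgebra isAlgebra

    private
      Pair : Set
      Pair = Point true × Point false

      Sep : Pair → Set ℓ
      Sep (x , y) = Separated T x y

      Split : List Pair → Pair → Vec (V (𝔾 true)) t → Vec (V (𝔾 false)) t → Set
      Split L (x , y) u v = (take t x ++ u , take t y ++ v) ∈ˡ L × (u ++ drop t x , v ++ drop t y) ∈ˡ L

    -- One round of the algorithm with equality of the previous colours replaced by membership in
    -- `L`. When every member of `L` satisfies it, equality of colours follows by induction on the
    -- number of rounds.
    record Bisimilar (L : List Pair) (p : Pair) : Set where
      field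
        sameType : atp (𝔾 true) (proj₁ p) ≡ atp (𝔾 false) (proj₂ p)
        shuffled : ∀ σ → (permute σ (proj₁ p) , permute σ (proj₂ p)) ∈ˡ L
        split    : Match (Split L p) (allTuples true) (allTuples false)

    𝟙-separated : ∀ {x y} {P : ∀ s → Point s → Set} (P? : ∀ s x → Dec (P s x)) →
      T (λ s x → 𝟙 (P? s x)) → does (P? true x) ≡ does (P? false y) ⊎ Sep (x , y)
    𝟙-separated {x} {y} P? T𝟙 with does (P? true x) Bool.≟ does (P? false y)
    ... | yes eq = inj₁ eq
    ... | no  ≢  = inj₂ (_ , T𝟙 , λ eq → ≢ (𝟙-injective (P? true x) (P? false y) eq))

    sameType-or-separated : ∀ p → atp (𝔾 true) (proj₁ p) ≡ atp (𝔾 false) (proj₂ p) ⊎ Sep p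
    sameType-or-separated (x , y) =
      Sum.map₁ (λ eq → Vec.tabulate-cong λ i → Vec.tabulate-cong λ j → eq i j)
        (all-or-Fin λ i → all-or-Fin λ j → both
          (𝟙-separated (λ s x → lookup x i ≟ lookup x j) (equal i j))
          (𝟙-separated (λ s x → Graph.E? (𝔾 s) (lookup x i) (lookup x j)) (adjacent i j)))
      where
      both : ∀ {a b c d : Bool} → a ≡ b ⊎ Sep (x , y) → c ≡ d ⊎ Sep (x , y) → (a , c) ≡ (b , d) ⊎ Sep (x , y)
      both (inj₂ s) _        = inj₂ s
      both (inj₁ _) (inj₂ s) = inj₂ s
      both (inj₁ e) (inj₁ f) = inj₁ (cong₂ _,_ e f)

    -- With x = x′x″, these functions of y separate pairs (x′y, yx″), and their sums
    -- over y are values at x of functions in T.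
    data Tensor (x : ∀ s → Point s) : Fn (λ s → Vec (V (𝔾 s)) t) → Set ℓ where
      pure  : ∀ {f g} → T f → T g → Tensor x λ s y → f s (take t (x s) ++ y) * g s (y ++ drop t (x s))
      _⊕_   : ∀ {f g} → Tensor x f → Tensor x g → Tensor x λ s y → f s y + g s y
      equiv : ∀ {f g} → (∀ s y → f s y ≡ g s y) → Tensor x f → Tensor x g

    -- Pure tensors multiply to a pure tensor, because the left and right factors can be multiplied
    -- separately within `T`; distributivity extends this to sums.
    tensor-isAlgebra : ∀ x → IsAlgebra (Tensor x)
    tensor-isAlgebra x = record
      { const = λ c → equiv (λ _ _ → ℤ.*-identityʳ c) (pure (const c) (const 1ℤ))
      ; add   = _⊕_
      ; mul   = _⊗_
      }
      where
      pure-⊗ : ∀ {f g h} → T f → T g → Tensor x h →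
               Tensor x λ s y → (f s (take t (x s) ++ y) * g s (y ++ drop t (x s))) * h s y
      pure-⊗ {f} {g} Tf Tg (pure {f′} {g′} Tf′ Tg′) =
        equiv (λ s y → *-interchange (f s (take t (x s) ++ y)) _ _ _) (pure (mul Tf Tf′) (mul Tg Tg′))
      pure-⊗ {f} {g} Tf Tg (h ⊕ k)       =
        equiv (λ s y → sym (ℤ.*-distribˡ-+ (f s (take t (x s) ++ y) * g s (y ++ drop t (x s))) _ _))
              (pure-⊗ Tf Tg h ⊕ pure-⊗ Tf Tg k)
      pure-⊗ {f} {g} Tf Tg (equiv eq h)  =
        equiv (λ s y → cong (f s (take t (x s) ++ y) * g s (y ++ drop t (x s)) *_) (eq s y)) (pure-⊗ Tf Tg h)
      _⊗_ : ∀ {h k} → Tensor x h → Tensor x k → Tensor x λ s y → h s y * k s y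
      pure Tf Tg ⊗ k = pure-⊗ Tf Tg k
      _⊗_ {k = k} (_⊕_ {f} {g} h h′) K =
        equiv (λ s y → sym (ℤ.*-distribʳ-+ (k s y) (f s y) (g s y))) ((h ⊗ K) ⊕ (h′ ⊗ K))
      _⊗_ {k = k} (equiv eq h) K = equiv (λ s y → cong (_* k s y) (eq s y)) (h ⊗ K)

    tensor-sum : ∀ {x f} → Tensor x f → ∃ λ g → T g × ∀ s → ∑ (allTuples s) (f s) ≡ g s (x s)
    tensor-sum (pure Tf Tg) = _ , compose Tf Tg , λ s → refl
    tensor-sum (h ⊕ k) with g , Tg , eq ← tensor-sum h | g′ , Tg′ , eq′ ← tensor-sum k =
      _ , add Tg Tg′ , λ s → trans (∑-+ (allTuples s) _ _) (cong₂ _+_ (eq s) (eq′ s))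
    tensor-sum (equiv e h) with g , Tg , eq ← tensor-sum h =
      g , Tg , λ s → trans (sym (∑-cong (allTuples s) (e s))) (eq s)

    module _ (L : List Pair) (inv : ∀ p → p ∈ˡ L ⊎ Sep p) where

      permuted-or-separated : ∀ x y → (∀ σ → (permute σ x , permute σ y) ∈ˡ L) ⊎ Sep (x , y)
      permuted-or-separated x y = all-or-Perm (t ℕ.+ t)
        (λ π≈ρ → subst (_∈ˡ L) (cong₂ _,_ (Vec.tabulate-cong λ i → cong (lookup x) (π≈ρ i))
                                          (Vec.tabulate-cong λ i → cong (lookup y) (π≈ρ i))))
        λ σ → Sum.map₂ (λ (f , Tf , ≢) → _ , perm σ Tf , ≢) (inv (permute σ x , permute σ y))

      -- If the middle tuples cannot be matched, some tensor has different sums over them. By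
      -- `tensor-sum` these sums are the values at `x` and `y` of one function in `T`, which
      -- therefore separates the original pair.
      split-or-separated : ∀ x y → Match (Split L (x , y)) (allTuples true) (allTuples false) ⊎ Sep (x , y)
      split-or-separated x y = Sum.map₂
        (λ (f , Tf , ≢) → let g , Tg , eq = tensor-sum Tf in
           g , Tg , λ e → ≢ (trans (eq true) (trans e (sym (eq false)))))
        (Separation.match-or-unbalanced (tensor-isAlgebra x,y) allTuples split?)
        where
        x,y : ∀ s → Point s
        x,y true  = x
        x,y false = y

        split? : ∀ u v → Split L (x , y) u v ⊎ Separated (Tensor x,y) u v
        split? u v with inv (take t x ++ u , take t y ++ v) | inv (u ++ drop t x , v ++ drop t y)
        ... | inj₁ l | inj₁ r = inj₁ (l , r)
        -- A function separating one half of the split becomes a tensor when the other factor is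
        -- taken to be 1.
        ... | inj₂ (f , Tf , ≢) | _ = inj₂ (_ , pure Tf (const 1ℤ) , λ eq →
          ≢ (trans (sym (ℤ.*-identityʳ _)) (trans eq (ℤ.*-identityʳ _))))
        ... | inj₁ _ | inj₂ (f , Tf , ≢) = inj₂ (_ , pure (const 1ℤ) Tf , λ eq →
          ≢ (trans (sym (ℤ.*-identityˡ _)) (trans eq (ℤ.*-identityˡ _))))

      bisimilar-or-separated : ∀ p → Bisimilar L p ⊎ Sep p
      bisimilar-or-separated p@(x , y)
        with sameType-or-separated p | permuted-or-separated x y | split-or-separated x y
      ... | inj₂ s | _      | _      = inj₂ s
      ... | inj₁ _ | inj₂ s | _      = inj₂ s
      ... | inj₁ _ | inj₁ _ | inj₂ s = inj₂ s
      ... | inj₁ a | inj₁ b | inj₁ c = inj₁ record { sameType = a ; shuffled = b ; split = c }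

    bisimilar⇒≈ : ∀ {L} → (∀ p → p ∈ˡ L → Bisimilar L p) → ∀ i {x y} → (x , y) ∈ˡ L →
                  Setoid._≈_ (Colour i) (mwl (𝔾 true) i x) (mwl (𝔾 false) i y)
    bisimilar⇒≈ bisim zero    xy∈ = Bisimilar.sameType (bisim _ xy∈)
    bisimilar⇒≈ {L} bisim (suc i) xy∈ =
      half xy∈ , Match⇒↭ {S = ×-setoid (Half (Colour i)) (Half (Colour i))}
        (Match-map (λ (l , r) → half l , half r) (Bisimilar.split (bisim _ xy∈)))
      where
      half : ∀ {x y} → (x , y) ∈ˡ L → ∀ σ → Setoid._≈_ (Colour i) (mwl½ (𝔾 true) i x σ) (mwl½ (𝔾 false) i y σ)
      half xy∈ σ = bisimilar⇒≈ bisim i (Bisimilar.shuffled (bisim _ xy∈) σ)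

    balanced⇒notDistinguished :
      (∀ {f} → T f → ∑ (allPairs true) (f true) ≡ ∑ (allPairs false) (f false)) →
      NotDistinguished (𝔾 true) (𝔾 false)
    balanced⇒notDistinguished balanced
      with L , inv , bisim ← refine bisimilar-or-separated
             (cartesianProduct (tuples _ _) (tuples _ _))
             (λ (x , y) → inj₁ (∈ˡ.∈-cartesianProduct⁺ (proj₂ (tuples-enumeration _ _) x)
                                                        (proj₂ (tuples-enumeration _ _) y)))
      -- The surviving list plays the role of `R`: `inv` says that every pair is either in it or
      -- separated. Balance excludes the second outcome.
      with Separation.match-or-unbalanced isAlgebra allPairs (λ x y → inv (x , y))
    ... | inj₂ (f , Tf , ≢) = contradiction (balanced Tf) ≢
    ... | inj₁ m = subst₂ (Permutation (Setoid._≈_ StableColour))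
      (stable true) (stable false)
      (Match⇒↭ {S = StableColour} (Match-map (λ xy∈ i → bisimilar⇒≈ bisim i xy∈) m))
      where
      stable : ∀ s → List.map (mwl∞ (𝔾 s)) (allPairs s) ≡ stableColours (𝔾 s)
      stable s = sym (List.map-∘ (cartesianProduct (allTuples s) (allTuples s)))

-- Linear spans and their coherence

module _ (t : ℕ) (𝔾 : Bool → Graph) {I : Set ℓ} (val : I → Fn (Point t 𝔾)) where

  private
    Pt : Bool → Set
    Pt = Point t 𝔾

    _∙′_ : Fn Pt → Fn Pt → Fn Pt
    _∙′_ = _∙_ t 𝔾

  -- Integer linear combinations of the generators. The constructor `equiv` closes them under
  -- pointwise equality, the only equality of functions that the later identities provide.
  data Span : Fn Pt → Set ℓ where
    basic : ∀ i → Span (val i)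
    _⊕_   : ∀ {f g} → Span f → Span g → Span λ s x → f s x + g s x
    scale : ∀ c {f} → Span f → Span λ s x → c * f s x
    equiv : ∀ {f g} → (∀ s x → f s x ≡ g s x) → Span f → Span g

  record IsLinear (Λ : Fn Pt → Fn Pt) : Set where
    field
      +-homo   : ∀ f g s x → Λ (λ s x → f s x + g s x) s x ≡ Λ f s x + Λ g s x
      *-homo   : ∀ c f s x → Λ (λ s x → c * f s x) s x ≡ c * Λ f s x
      respects : ∀ {f g} → (∀ s x → f s x ≡ g s x) → ∀ s x → Λ f s x ≡ Λ g s x

  Span-linear : ∀ {Λ} → IsLinear Λ → (∀ i → Span (Λ (val i))) → ∀ {f} → Span f → Span (Λ f)
  Span-linear lin b (basic i)       = b i
  Span-linear lin b (p ⊕ q)         =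
    equiv (λ s x → sym (IsLinear.+-homo lin _ _ s x)) (Span-linear lin b p ⊕ Span-linear lin b q)
  Span-linear lin b (scale c {f} p) =
    equiv (λ s x → sym (IsLinear.*-homo lin c f s x)) (scale c (Span-linear lin b p))
  Span-linear lin b (equiv eq p)    = equiv (IsLinear.respects lin eq) (Span-linear lin b p)

  Span-bilinear : ∀ {B : Fn Pt → Fn Pt → Fn Pt} →
                  (∀ f → IsLinear (B f)) → (∀ g → IsLinear (λ f → B f g)) →
                  (∀ i j → Span (B (val i) (val j))) → ∀ {f g} → Span f → Span g → Span (B f g)
  Span-bilinear linʳ linˡ b p q =
    Span-linear (linˡ _) (λ i → Span-linear (linʳ _) (b i) q) p

  Span-balanced : (∀ i → ∑ (allPairs t 𝔾 true) (val i true) ≡ ∑ (allPairs t 𝔾 false) (val i false)) →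
                  ∀ {f} → Span f → ∑ (allPairs t 𝔾 true) (f true) ≡ ∑ (allPairs t 𝔾 false) (f false)
  Span-balanced b (basic i) = b i
  Span-balanced b (p ⊕ q) = trans (∑-+ (allPairs t 𝔾 true) _ _) (trans
    (cong₂ _+_ (Span-balanced b p) (Span-balanced b q)) (sym (∑-+ (allPairs t 𝔾 false) _ _)))
  Span-balanced b (scale c {f} p) = trans (∑-*ˡ (allPairs t 𝔾 true) c (f true))
    (trans (cong (c *_) (Span-balanced b p)) (sym (∑-*ˡ (allPairs t 𝔾 false) c (f false))))
  Span-balanced b (equiv eq p) = trans (sym (∑-cong (allPairs t 𝔾 true) (eq true)))
    (trans (Span-balanced b p) (∑-cong (allPairs t 𝔾 false) (eq false)))

  -- Conditions on possibly dependent generators that suffice for coherence of their span: permuting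
  -- coordinates is linear and both products are bilinear, so closure has to be verified on
  -- generators only.
  record IsBasis : Set ℓ where
    field
      one      : Span λ _ _ → 1ℤ
      equal    : ∀ i j → Span λ s x → 𝟙 (lookup x i ≟ lookup x j)
      adjacent : ∀ i j → Span λ s x → 𝟙 (Graph.E? (𝔾 s) (lookup x i) (lookup x j))
      mul      : ∀ i j → Span λ s x → val i s x * val j s x
      perm     : ∀ σ i → Span λ s x → val i s (permute σ x)
      compose  : ∀ i j → Span (val i ∙′ val j)

  private

    _⋆_ : Fn Pt → Fn Pt → Fn Pt
    (f ⋆ g) s x = f s x * g s x

    ⋆-linearʳ : ∀ f → IsLinear (f ⋆_)
    ⋆-linearʳ f = record
      { +-homo   = λ g h s x → ℤ.*-distribˡ-+ (f s x) (g s x) (h s x)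
      ; *-homo   = λ c g s x → x∙yz≈y∙xz (f s x) c (g s x)
      ; respects = λ eq s x → cong (λ k → f s x * k) (eq s x)
      }

    ⋆-linearˡ : ∀ g → IsLinear (_⋆ g)
    ⋆-linearˡ g = record
      { +-homo   = λ f h s x → ℤ.*-distribʳ-+ (g s x) (f s x) (h s x)
      ; *-homo   = λ c f s x → ℤ.*-assoc c (f s x) (g s x)
      ; respects = λ eq s x → cong (λ k → k * g s x) (eq s x)
      }

    ∙-linearʳ : ∀ f → IsLinear (f ∙′_)
    ∙-linearʳ f = record
      { +-homo   = λ g h s x → trans
          (∑-cong (allTuples t 𝔾 s) λ y → ℤ.*-distribˡ-+ (f s (take t x ++ y)) (g s (y ++ drop t x)) (h s (y ++ drop t x)))
          (∑-+ (allTuples t 𝔾 s) _ _)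
      ; *-homo   = λ c g s x → trans
          (∑-cong (allTuples t 𝔾 s) λ y → x∙yz≈y∙xz (f s (take t x ++ y)) c (g s (y ++ drop t x)))
          (∑-*ˡ (allTuples t 𝔾 s) c _)
      ; respects = λ eq s x → ∑-cong (allTuples t 𝔾 s) λ y → cong (λ k → f s (take t x ++ y) * k) (eq s _)
      }

    ∙-linearˡ : ∀ g → IsLinear (_∙′ g)
    ∙-linearˡ g = record
      { +-homo   = λ f h s x → trans
          (∑-cong (allTuples t 𝔾 s) λ y → ℤ.*-distribʳ-+ (g s (y ++ drop t x)) (f s (take t x ++ y)) (h s (take t x ++ y)))
          (∑-+ (allTuples t 𝔾 s) _ _)
      ; *-homo   = λ c f s x → trans
          (∑-cong (allTuples t 𝔾 s) λ y → ℤ.*-assoc c (f s (take t x ++ y)) (g s (y ++ drop t x)))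
          (∑-*ˡ (allTuples t 𝔾 s) c _)
      ; respects = λ eq s x → ∑-cong (allTuples t 𝔾 s) λ y → cong (λ k → k * g s (y ++ drop t x)) (eq s _)
      }

  Span-isCoherent : IsBasis → IsCoherent t 𝔾 Span
  Span-isCoherent basis = record
    { isAlgebra = record
      { const = λ c → equiv (λ s x → ℤ.*-identityʳ c) (scale c B.one)
      ; add   = _⊕_
      ; mul   = Span-bilinear ⋆-linearʳ ⋆-linearˡ B.mul
      }
    ; ext       = equiv
    ; equal     = B.equal
    ; adjacent  = B.adjacent
    ; perm      = λ σ → Span-linear (record
      { +-homo = λ f g s x → refl
      ; *-homo = λ c f s x → refl
      ; respects   = λ eq s x → eq s (permute σ x)
      }) (B.perm σ)
    ; compose   = Span-bilinear ∙-linearʳ ∙-linearˡ B.compose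
    }
    where module B = IsBasis basis

-- Permuted tuples

lookup-ext : ∀ {n} {x y : Vec A n} → (∀ i → lookup x i ≡ lookup y i) → x ≡ y
lookup-ext {x = x} {y} eq =
  trans (sym (Vec.tabulate∘lookup x)) (trans (Vec.tabulate-cong eq) (Vec.tabulate∘lookup y))

lookup-permute : ∀ {A : Set} {n} (σ : Permutation′ n) (x : Vec A n) i → lookup (permute σ x) i ≡ lookup x (σ ⟨$⟩ʳ i)
lookup-permute σ x i = Vec.lookup∘tabulate _ i

permute-map : ∀ {A B : Set} {n} (σ : Permutation′ n) (f : A → B) (x : Vec A n) →
              map f (permute σ x) ≡ permute σ (map f x)
permute-map σ f x = trans (sym (Vec.tabulate-∘ f _))
  (Vec.tabulate-cong λ i → sym (Vec.lookup-map (σ ⟨$⟩ʳ i) f x))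

permute-flip : ∀ {A : Set} {n} (σ : Permutation′ n) (x : Vec A n) → permute σ (permute (Perm.flip σ) x) ≡ x
permute-flip σ x = trans
  (Vec.tabulate-cong λ i → trans (lookup-permute (Perm.flip σ) x (σ ⟨$⟩ʳ i)) (cong (lookup x) (Perm.inverseˡ σ)))
  (Vec.tabulate∘lookup x)

permute-flip′ : ∀ {A : Set} {n} (σ : Permutation′ n) (x : Vec A n) → permute (Perm.flip σ) (permute σ x) ≡ x
permute-flip′ σ x = trans
  (Vec.tabulate-cong λ i → trans (lookup-permute σ x _) (cong (lookup x) (Perm.inverseʳ σ)))
  (Vec.tabulate∘lookup x)

-- Gluings

module _ {A : Set} where

  Quotient : Rel A 0ℓ → Set
  Quotient R = ∃₂ λ k (p : A → Fin k) →
    StrictlySurjective _≡_ p × (∀ x y → (p x ≡ p y) ⇔ EqClosure R x y)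

  -- Adds the single identification of `x` with `y`. If the two are already in one class, nothing
  -- changes; otherwise `punchOut` deletes the class of `y`, whose members are sent to the class of
  -- `x`.
  identify : ∀ {R R′ : Rel A 0ℓ} (x y : A) → R′ ⇒ (λ u v → R u v ⊎ (u ≡ x × v ≡ y)) →
             R ⇒ R′ → R′ x y → Quotient R → Quotient R′
  identify {R} {R′} x y split R⇒R′ xR′y (k , p , surj , kernel) with p y ≟ p x
  ... | yes py≡px = k , p , surj , λ u v → mk⇔
    (EqClosure.map R⇒R′ ∘ Equivalence.to (kernel u v))
    (EqClosure.gfold isEquivalence p λ r → [ (λ r → Equivalence.from (kernel _ _) (fwd r ◅ ε))
                                            , (λ { (refl , refl) → sym py≡px }) ]′ (split r))
  identify x _ _ _ _ (zero , p , _) | no _ with () ← p x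
  identify {R} {R′} x y split R⇒R′ xR′y (suc k , p , surj , kernel) | no py≢px =
    k , merge ∘ p , merge-surj , λ u v → mk⇔ (merge-kernel u v)
      (EqClosure.gfold isEquivalence (merge ∘ p) λ r → [ (λ r → cong merge (Equivalence.from (kernel _ _) (fwd r ◅ ε)))
                                            , (λ { (refl , refl) → merge-xy }) ]′ (split r))
    where
    merge : Fin (suc k) → Fin k
    merge v with p y ≟ v
    ... | yes _    = punchOut py≢px
    ... | no  py≢v = punchOut py≢v

    merge-xy : merge (p x) ≡ merge (p y)
    merge-xy with p y ≟ p x | p y ≟ p y
    ... | yes py≡px | _        = contradiction py≡px py≢px
    ... | no _      | yes _    = Fin.punchOut-cong (p y) refl
    ... | no _      | no py≢py = contradiction refl py≢py

    merge-punchIn : ∀ v → merge (punchIn (p y) v) ≡ v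
    merge-punchIn v with p y ≟ punchIn (p y) v
    ... | yes eq = contradiction (sym eq) (Fin.punchInᵢ≢i (p y) v)
    ... | no _   = trans (Fin.punchOut-cong (p y) refl) (Fin.punchOut-punchIn (p y))

    merge-surj : StrictlySurjective _≡_ (merge ∘ p)
    merge-surj v with u , pu≡ ← surj (punchIn (p y) v) = u , trans (cong merge pu≡) (merge-punchIn v)

    lift : ∀ {u v} → p u ≡ p v → EqClosure R′ u v
    lift = EqClosure.map R⇒R′ ∘ Equivalence.to (kernel _ _)

    merge-kernel : ∀ u v → merge (p u) ≡ merge (p v) → EqClosure R′ u v
    merge-kernel u v eq with p y ≟ p u | p y ≟ p v
    ... | yes e | yes f = lift (trans (sym e) f)
    ... | no ≢u | no ≢v = lift (Fin.punchOut-injective ≢u ≢v eq)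
    -- Classes that were distinct merge only if one of them is that of `y` and the other that of
    -- `x`, so the connecting path crosses the new identification once.
    ... | yes e | no ≢v = lift (sym e) ◅◅ bwd xR′y ◅ lift (Fin.punchOut-injective py≢px ≢v eq)
    ... | no ≢u | yes f = lift (Fin.punchOut-injective ≢u py≢px eq) ◅◅ fwd xR′y ◅ lift f

module _ (F F′ : Graph) where

  quotient : ∀ {m} (a : Vec (V F) m) (b : Vec (V F′) m) → Quotient (Identified a b)
  quotient [] [] = _ , join (Graph.order F) (Graph.order F′) ,
    (λ v → splitAt (Graph.order F) v , Fin.join-splitAt (Graph.order F) (Graph.order F′) v) , λ x y → mk⇔
      (λ eq → subst (EqClosure _ x) (trans (sym (split-join x)) (trans (cong (splitAt (Graph.order F)) eq) (split-join y))) ε)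
      (EqClosure.gfold isEquivalence _ λ { (identified ()) })
    where
    split-join : ∀ x → splitAt (Graph.order F) (join (Graph.order F) (Graph.order F′) x) ≡ x
    split-join = Fin.splitAt-join (Graph.order F) (Graph.order F′)
  quotient (x ∷ a) (y ∷ b) = identify (inj₁ x) (inj₂ y)
    (λ { (identified zero) → inj₂ (refl , refl) ; (identified (suc i)) → inj₁ (identified i) })
    (λ { (identified i) → identified (suc i) }) (identified zero) (quotient a b)

  abstract
    -- Sealed, so that later arguments use only the properties recorded in `IsGluing`, which hold of
    -- every representative in the class.
    gluing : ∀ {m} (a : Vec (V F) m) (b : Vec (V F′) m) → ∃₂ λ K p → IsGluing F F′ K a b p
    gluing a b = let k , p , surj , kernel = quotient a b in glue p , p , record
      { surjective = surj
      ; kernel     = kernel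
      ; edges      = λ v w → mk⇔ id id
      }
      where
      module _ {k} (p : V F ⊎ V F′ → Fin k) where
        E : Rel (Fin k) 0ℓ
        E v w = ∃₂ λ x y → p x ≡ v × p y ≡ w × Sum.Pointwise (Graph.E F) (Graph.E F′) x y

        E? : ∀ v w → Dec (E v w)
        E? v w = map′
          [ (λ (x , y , e , f , g) → inj₁ x , inj₁ y , e , f , inj₁ g)
          , (λ (x , y , e , f , g) → inj₂ x , inj₂ y , e , f , inj₂ g) ]′
          (λ { (inj₁ x , inj₁ y , e , f , inj₁ g) → inj₁ (x , y , e , f , g)
             ; (inj₂ x , inj₂ y , e , f , inj₂ g) → inj₂ (x , y , e , f , g) })
          (Fin.any? (λ x → Fin.any? λ y → p (inj₁ x) ≟ v ×-dec p (inj₁ y) ≟ w ×-dec Graph.E? F x y)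
           ⊎-dec
           Fin.any? (λ x → Fin.any? λ y → p (inj₂ x) ≟ v ×-dec p (inj₂ y) ≟ w ×-dec Graph.E? F′ x y))

        glue : Graph
        glue = record
          { order = k
          ; E     = E
          ; E?    = E?
          ; E-sym = λ (x , y , e , f , g) → y , x , f , e , Sum.⊎-symmetric (Graph.E-sym F) (Graph.E-sym F′) g
          }

-- Labelled homomorphism counts

IsLabelledHom : ∀ (F : Graph) {m} (l : Vec (V F) m) (G : Graph) → Vec (V G) m → Vec (V G) (Graph.order F) → Set
IsLabelledHom F l G x h = IsHom F G h × map (lookup h) l ≡ x

isLabelledHom? : ∀ F {m} (l : Vec (V F) m) G x h → Dec (IsLabelledHom F l G x h)
isLabelledHom? F l G x h = isHom? F G h ×-dec map (lookup h) l ≟ᵛ x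

maps : ∀ F G → List (Vec (V G) (Graph.order F))
maps F G = tuples (Graph.order G) (Graph.order F)

maps-enumeration : ∀ F G → IsEnumeration (maps F G)
maps-enumeration F G = tuples-enumeration (Graph.order G) (Graph.order F)

labelledHom : ∀ F {m} (l : Vec (V F) m) G → Vec (V G) m → ℤ
labelledHom F l G x = ∑ (maps F G) λ h → 𝟙 (isLabelledHom? F l G x h)

homᵇ : ∀ {t} (F : BilabelledGraph t) G → Vec (V G) (t ℕ.+ t) → ℤ
homᵇ F = labelledHom (graph F) (labels F)

-- Every homomorphism induces exactly one tuple on the labels, so sorting by that tuple partitions
-- the homomorphisms.
hom-∑ : ∀ F {m} (l : Vec (V F) m) G {xs} → IsEnumeration xs → + hom F G ≡ ∑ xs (labelledHom F l G)
hom-∑ F l G {xs} enum = begin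
  + hom F G
    ≡⟨ length-filter (isHom? F G) (maps F G) ⟩
  ∑ (maps F G) (λ h → 𝟙 (isHom? F G h))
    ≡⟨ ∑-cong (maps F G) (λ h → trans
         (𝟙-cong (isHom? F G h) (isLabelledHom? F l G _ h) (_, refl) proj₁)
         (sym (∑-δ enum (λ x → isLabelledHom? F l G x h) (map (lookup h) l) (sym ∘ proj₂)))) ⟩
  ∑ (maps F G) (λ h → ∑ xs (λ x → 𝟙 (isLabelledHom? F l G x h)))
    ≡⟨ ∑-swap (maps F G) xs _ ⟩
  ∑ xs (labelledHom F l G) ∎
  where open ≡-Reasoning

-- Homomorphisms from a gluing

module _ {F F′ K : Graph} {m} {a : Vec (V F) m} {b : Vec (V F′) m} {p : V F ⊎ V F′ → V K}
         (gluing : IsGluing F F′ K a b p) (G : Graph) where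
  open IsGluing gluing

  restrictˡ : Vec (V G) (Graph.order K) → Vec (V G) (Graph.order F)
  restrictˡ h = tabulate λ v → lookup h (p (inj₁ v))

  restrictʳ : Vec (V G) (Graph.order K) → Vec (V G) (Graph.order F′)
  restrictʳ h = tabulate λ v → lookup h (p (inj₂ v))

  copair : Vec (V G) (Graph.order F) → Vec (V G) (Graph.order F′) → V F ⊎ V F′ → V G
  copair h h′ = [ lookup h , lookup h′ ]′

  -- Evaluates at the preimage chosen by surjectivity, so it is total and can serve as the inverse
  -- in `∑-bijection`. For compatible maps the choice is immaterial, since `copair` is constant on
  -- the classes of the kernel.
  extend : Vec (V G) (Graph.order F) → Vec (V G) (Graph.order F′) → Vec (V G) (Graph.order K)
  extend h h′ = tabulate λ w → copair h h′ (proj₁ (surjective w))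

  lookup-restrictˡ : ∀ h v → lookup (restrictˡ h) v ≡ lookup h (p (inj₁ v))
  lookup-restrictˡ h v = Vec.lookup∘tabulate _ v

  lookup-restrictʳ : ∀ h v → lookup (restrictʳ h) v ≡ lookup h (p (inj₂ v))
  lookup-restrictʳ h v = Vec.lookup∘tabulate _ v

  map-restrictˡ : ∀ h {n} (l : Vec (V F) n) → map (lookup h) (map (p ∘ inj₁) l) ≡ map (lookup (restrictˡ h)) l
  map-restrictˡ h l = trans (sym (Vec.map-∘ _ _ l)) (Vec.map-cong (sym ∘ lookup-restrictˡ h) l)

  map-restrictʳ : ∀ h {n} (l : Vec (V F′) n) → map (lookup h) (map (p ∘ inj₂) l) ≡ map (lookup (restrictʳ h)) l
  map-restrictʳ h l = trans (sym (Vec.map-∘ _ _ l)) (Vec.map-cong (sym ∘ lookup-restrictʳ h) l)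

  restrictˡ-hom : ∀ h → IsHom K G h → IsHom F G (restrictˡ h)
  restrictˡ-hom h hom x y e = subst₂ (Graph.E G) (sym (lookup-restrictˡ h x)) (sym (lookup-restrictˡ h y))
    (hom _ _ (Equivalence.from (edges _ _) (_ , _ , refl , refl , inj₁ e)))

  restrictʳ-hom : ∀ h → IsHom K G h → IsHom F′ G (restrictʳ h)
  restrictʳ-hom h hom x y e = subst₂ (Graph.E G) (sym (lookup-restrictʳ h x)) (sym (lookup-restrictʳ h y))
    (hom _ _ (Equivalence.from (edges _ _) (_ , _ , refl , refl , inj₂ e)))

  restrict-compatible : ∀ h → map (lookup (restrictˡ h)) a ≡ map (lookup (restrictʳ h)) b
  restrict-compatible h = lookup-ext λ i → begin
    lookup (map (lookup (restrictˡ h)) a) i ≡⟨ Vec.lookup-map i _ a ⟩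
    lookup (restrictˡ h) (lookup a i)       ≡⟨ lookup-restrictˡ h _ ⟩
    lookup h (p (inj₁ (lookup a i)))        ≡⟨ cong (lookup h) (Equivalence.from (kernel _ _) (fwd (identified i) ◅ ε)) ⟩
    lookup h (p (inj₂ (lookup b i)))        ≡⟨ lookup-restrictʳ h _ ⟨
    lookup (restrictʳ h) (lookup b i)       ≡⟨ Vec.lookup-map i _ b ⟨
    lookup (map (lookup (restrictʳ h)) b) i ∎
    where open ≡-Reasoning

  copair-restrict : ∀ h z → copair (restrictˡ h) (restrictʳ h) z ≡ lookup h (p z)
  copair-restrict h (inj₁ v) = lookup-restrictˡ h v
  copair-restrict h (inj₂ v) = lookup-restrictʳ h v

  extend-restrict : ∀ h → extend (restrictˡ h) (restrictʳ h) ≡ h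
  extend-restrict h = lookup-ext λ w → trans (Vec.lookup∘tabulate _ w)
    (trans (copair-restrict h _) (cong (lookup h) (proj₂ (surjective w))))

  module _ (h : Vec (V G) (Graph.order F)) (h′ : Vec (V G) (Graph.order F′))
           (compatible : map (lookup h) a ≡ map (lookup h′) b) where

    lookup-extend : ∀ z → lookup (extend h h′) (p z) ≡ copair h h′ z
    lookup-extend z = trans (Vec.lookup∘tabulate _ (p z))
      (EqClosure.gfold isEquivalence (copair h h′)
        (λ { (identified i) → trans (sym (Vec.lookup-map i _ a))
               (trans (cong (λ x → lookup x i) compatible) (Vec.lookup-map i _ b)) })
        (Equivalence.to (kernel _ z) (proj₂ (surjective (p z)))))

    restrictˡ-extend : restrictˡ (extend h h′) ≡ h
    restrictˡ-extend = lookup-ext λ v → trans (lookup-restrictˡ (extend h h′) v) (lookup-extend (inj₁ v))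

    restrictʳ-extend : restrictʳ (extend h h′) ≡ h′
    restrictʳ-extend = lookup-ext λ v → trans (lookup-restrictʳ (extend h h′) v) (lookup-extend (inj₂ v))

    extend-hom : IsHom F G h → IsHom F′ G h′ → IsHom K G (extend h h′)
    extend-hom hom hom′ v w e with Equivalence.to (edges v w) e
    ... | z , z′ , refl , refl , e′ =
      subst₂ (Graph.E G) (sym (lookup-extend z)) (sym (lookup-extend z′)) (edge′ e′)
      where
      edge′ : ∀ {z z′} → Sum.Pointwise (Graph.E F) (Graph.E F′) z z′ → Graph.E G (copair h h′ z) (copair h h′ z′)
      edge′ (inj₁ e) = hom _ _ e
      edge′ (inj₂ e) = hom′ _ _ e

module _ {t : ℕ} {F F′ K : BilabelledGraph t} (G : Graph) where

  private
    mapPairs : List (Vec (V G) (Graph.order (graph F)) × Vec (V G) (Graph.order (graph F′)))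
    mapPairs = cartesianProduct (maps (graph F) G) (maps (graph F′) G)

    mapPairs-enumeration : IsEnumeration mapPairs
    mapPairs-enumeration = ×-enumeration (maps-enumeration (graph F) G) (maps-enumeration (graph F′) G)

  -- Restriction and extension are inverse to each other. Two homomorphisms inducing the same tuple
  -- `x` on their labels are automatically compatible, so the pairs are unconstrained and their
  -- number is a product.
  homᵇ-parallel : IsParallel F F′ K → ∀ x → homᵇ K G x ≡ homᵇ F G x * homᵇ F′ G x
  homᵇ-parallel (p , gl , ins≡ , outs≡) x = begin
    homᵇ K G x
      ≡⟨ ∑-bijection (maps-enumeration (graph K) G)
           mapPairs-enumeration
           _≟ᵛ_ (×-≡-dec _≟ᵛ_ _≟ᵛ_)
           (isLabelledHom? (graph K) (labels K) G x)
           (λ (h , h′) → homF? h ×-dec homF′? h′)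
           (λ h → restrictˡ gl G h , restrictʳ gl G h) (uncurry (extend gl G))
           (λ {h} (hom , e) →
             let e′ = trans (sym (map-restrictˡ gl G h (labels F))) (trans (cong (map (lookup h)) (sym labels≡)) e) in
             (restrictˡ-hom gl G h hom , e′) ,
             (restrictʳ-hom gl G h hom , trans (sym (restrict-compatible gl G h)) e′))
           (λ {(h , h′)} ((hom , e) , (hom′ , e′)) → let c = trans e (sym e′) in
             extend-hom gl G h h′ c hom hom′ ,
             trans (cong (map (lookup (extend gl G h h′))) labels≡)
               (trans (map-restrictˡ gl G (extend gl G h h′) (labels F))
                 (trans (cong (λ k → map (lookup k) (labels F)) (restrictˡ-extend gl G h h′ c)) e)))
           (λ {h} _ → extend-restrict gl G h)
           (λ {(h , h′)} ((_ , e) , (_ , e′)) → let c = trans e (sym e′) in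
             cong₂ _,_ (restrictˡ-extend gl G h h′ c) (restrictʳ-extend gl G h h′ c)) ⟩
    ∑ mapPairs (λ (h , h′) → 𝟙 (homF? h ×-dec homF′? h′))
      ≡⟨ ∑-cong mapPairs (λ (h , h′) → 𝟙-× (homF? h) (homF′? h′)) ⟩
    _ ≡⟨ ∑-× (maps (graph F) G) (maps (graph F′) G) _ _ ⟨
    homᵇ F G x * homᵇ F′ G x ∎
    where
    open ≡-Reasoning
    homF? : ∀ h → Dec (IsLabelledHom (graph F) (labels F) G x h)
    homF? = isLabelledHom? (graph F) (labels F) G x
    homF′? : ∀ h → Dec (IsLabelledHom (graph F′) (labels F′) G x h)
    homF′? = isLabelledHom? (graph F′) (labels F′) G x

    labels≡ : labels K ≡ map (p ∘ inj₁) (labels F)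
    labels≡ = trans (cong₂ _++_ ins≡ outs≡) (sym (Vec.map-++ (p ∘ inj₁) (ins F) (outs F)))

  -- The index `y` records the common image of the out-labels of `F` and the in-labels of `F′`.
  -- Homomorphisms of `K` thus correspond to triples (y , h , h′), where `y` enforces compatibility.
  homᵇ-series : IsSeries F F′ K → ∀ x → homᵇ K G x ≡
    ∑ (tuples (Graph.order G) t) λ y → homᵇ F G (take t x ++ y) * homᵇ F′ G (y ++ drop t x)
  homᵇ-series (p , gl , ins≡ , outs≡) x = begin
    homᵇ K G x
      ≡⟨ ∑-bijection (maps-enumeration (graph K) G)
           (×-enumeration (tuples-enumeration (Graph.order G) t) mapPairs-enumeration)
           _≟ᵛ_ (×-≡-dec _≟ᵛ_ (×-≡-dec _≟ᵛ_ _≟ᵛ_))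
           (isLabelledHom? (graph K) (labels K) G x)
           (λ (y , h , h′) → left? y h ×-dec right? y h′)
           (λ h → map (lookup (restrictˡ gl G h)) (outs F) , restrictˡ gl G h , restrictʳ gl G h)
           (λ (_ , h , h′) → extend gl G h h′)
           (λ {h} (hom , e) → let e₁ , e₂ = labels-split h e in
             (restrictˡ-hom gl G h hom , trans (Vec.map-++ _ (ins F) (outs F)) (cong (_++ _) e₁)) ,
             (restrictʳ-hom gl G h hom , trans (Vec.map-++ _ (ins F′) (outs F′))
               (cong₂ _++_ (sym (restrict-compatible gl G h)) e₂)))
           (λ {(y , h , h′)} ((hom , e) , (hom′ , e′)) →
             let e₁ , e₂ = ++-map h (ins F) (outs F) e
                 e₃ , e₄ = ++-map h′ (ins F′) (outs F′) e′
                 c = trans e₂ (sym e₃)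
             in extend-hom gl G h h′ c hom hom′ , labels-join (extend gl G h h′)
               (trans (cong (λ k → map (lookup k) (ins F)) (restrictˡ-extend gl G h h′ c)) e₁)
               (trans (cong (λ k → map (lookup k) (outs F′)) (restrictʳ-extend gl G h h′ c)) e₄))
           (λ {h} _ → extend-restrict gl G h)
           (λ {(y , h , h′)} ((hom , e) , (hom′ , e′)) →
             let e₁ , e₂ = ++-map h (ins F) (outs F) e
                 e₃ , e₄ = ++-map h′ (ins F′) (outs F′) e′
                 c = trans e₂ (sym e₃)
             in cong₂ _,_ (trans (cong (λ k → map (lookup k) (outs F)) (restrictˡ-extend gl G h h′ c)) e₂)
                          (cong₂ _,_ (restrictˡ-extend gl G h h′ c) (restrictʳ-extend gl G h h′ c))) ⟩
    ∑ (cartesianProduct (tuples (Graph.order G) t) mapPairs)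
      (λ (y , h , h′) → 𝟙 (left? y h ×-dec right? y h′))
      ≡⟨ ∑-cartesianProduct (tuples (Graph.order G) t) _ _ ⟩
    ∑ (tuples (Graph.order G) t) (λ y → ∑ mapPairs λ (h , h′) → 𝟙 (left? y h ×-dec right? y h′))
      ≡⟨ ∑-cong (tuples (Graph.order G) t) (λ y → trans
           (∑-cong mapPairs λ (h , h′) → 𝟙-× (left? y h) (right? y h′))
           (sym (∑-× (maps (graph F) G) (maps (graph F′) G) _ _))) ⟩
    ∑ (tuples (Graph.order G) t) (λ y → homᵇ F G (take t x ++ y) * homᵇ F′ G (y ++ drop t x)) ∎
    where
    open ≡-Reasoning
    left? : ∀ y h → Dec _
    left? y h = isLabelledHom? (graph F) (labels F) G (take t x ++ y) h
    right? : ∀ y h → Dec _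
    right? y h = isLabelledHom? (graph F′) (labels F′) G (y ++ drop t x) h

    ++-map : ∀ {F} h (u v : Vec (Fin F) t) {y z} → map (lookup {A = V G} h) (u ++ v) ≡ y ++ z →
             map (lookup h) u ≡ y × map (lookup h) v ≡ z
    ++-map h u v e = Vec.++-injective _ _ (trans (sym (Vec.map-++ (lookup h) u v)) e)

    ins-map : ∀ h → map (lookup h) (ins K) ≡ map (lookup (restrictˡ gl G h)) (ins F)
    ins-map h = trans (cong (map (lookup h)) ins≡) (map-restrictˡ gl G h (ins F))
    outs-map : ∀ h → map (lookup h) (outs K) ≡ map (lookup (restrictʳ gl G h)) (outs F′)
    outs-map h = trans (cong (map (lookup h)) outs≡) (map-restrictʳ gl G h (outs F′))

    labels-split : ∀ h → map (lookup h) (labels K) ≡ x →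
      map (lookup (restrictˡ gl G h)) (ins F) ≡ take t x × map (lookup (restrictʳ gl G h)) (outs F′) ≡ drop t x
    labels-split h e = let e₁ , e₂ = ++-map h (ins K) (outs K) (trans e (sym (Vec.take++drop≡id t x))) in
      trans (sym (ins-map h)) e₁ , trans (sym (outs-map h)) e₂

    labels-join : ∀ h → map (lookup (restrictˡ gl G h)) (ins F) ≡ take t x →
      map (lookup (restrictʳ gl G h)) (outs F′) ≡ drop t x → map (lookup h) (labels K) ≡ x
    labels-join h e₁ e₂ = trans (Vec.map-++ (lookup h) (ins K) (outs K))
      (trans (cong₂ _++_ (trans (ins-map h) e₁) (trans (outs-map h) e₂)) (Vec.take++drop≡id t x))

homᵇ-permuted : ∀ {t} σ (F : BilabelledGraph t) G x → homᵇ (permuteLabels σ F) G x ≡ homᵇ F G (permute (Perm.flip σ) x)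
homᵇ-permuted {t} σ F G x = ∑-cong (maps (graph F) G) λ h →
  𝟙-cong (isLabelledHom? (graph F) _ G x h) (isLabelledHom? (graph F) (labels F) G _ h)
    (map₂ λ e → trans (sym (permute-flip′ σ _)) (cong (permute (Perm.flip σ)) (trans (sym (permuted-labels h)) e)))
    (map₂ λ e → trans (permuted-labels h) (trans (cong (permute σ) e) (permute-flip σ x)))
  where
  permuted-labels : ∀ h → map (lookup {A = V G} h) (labels (permuteLabels σ F)) ≡ permute σ (map (lookup h) (labels F))
  permuted-labels h = trans (cong (map (lookup h)) (Vec.take++drop≡id t (permute σ (labels F))))
    (permute-map σ (lookup h) (labels F))

-- Atomic bilabelled graphs

module _ {F : Graph} {m} (l : Vec (V F) m) (labelled : ∀ v → v ∈ l) (G : Graph) where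

  fromLabels : Vec (V G) m → Vec (V G) (Graph.order F)
  fromLabels x = tabulate λ v → lookup x (Any.index (labelled v))

  fromLabels-unique : ∀ {x h} → map (lookup h) l ≡ x → h ≡ fromLabels x
  fromLabels-unique {h = h} refl = lookup-ext λ v → begin
    lookup h v                                        ≡⟨ cong (lookup h) (Any.lookup-index (labelled v)) ⟩
    lookup h (lookup l (Any.index (labelled v)))      ≡⟨ Vec.lookup-map (Any.index (labelled v)) (lookup h) l ⟨
    lookup (map (lookup h) l) (Any.index (labelled v)) ≡⟨ Vec.lookup∘tabulate _ v ⟨
    lookup (fromLabels (map (lookup h) l)) v          ∎
    where open ≡-Reasoning

  -- When all vertices are labelled, the tuple `x` leaves only one candidate map, so the count is 0
  -- or 1.
  labelledHom-atomic : ∀ x → labelledHom F l G x ≡ 𝟙 (isLabelledHom? F l G x (fromLabels x))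
  labelledHom-atomic x = ∑-δ (maps-enumeration F G) (isLabelledHom? F l G x) (fromLabels x) (fromLabels-unique ∘ proj₂)

module _ (t : ℕ) where

  withLabels : (F : Graph) → Vec (V F) (t ℕ.+ t) → BilabelledGraph t
  withLabels F l = bilabelled F (take t l) (drop t l)

  homᵇ-withLabels : ∀ F l G x → homᵇ (withLabels F l) G x ≡ labelledHom F l G x
  homᵇ-withLabels F l G x = cong (λ l → labelledHom F l G x) (Vec.take++drop≡id t l)

  atomic-withLabels : ∀ F l → (∀ v → v ∈ l) → 𝓛⁺ t (withLabels F l)
  atomic-withLabels F l v∈l = atomic λ v → subst (v ∈_) (sym (Vec.take++drop≡id t l)) (v∈l v)

edgeless : ℕ → Graph
edgeless n = record { order = n ; E = λ _ _ → ⊥ ; E? = λ _ _ → no λ () ; E-sym = λ () }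

-- For `i` equal to `j` this is a loop, so that adjacency of a coordinate to itself is covered as
-- well.
singleEdge : ∀ n → Fin n → Fin n → Graph
singleEdge n i j = record
  { order = n
  ; E     = λ u v → (u ≡ i × v ≡ j) ⊎ (u ≡ j × v ≡ i)
  ; E?    = λ u v → (u ≟ i ×-dec v ≟ j) ⊎-dec (u ≟ j ×-dec v ≟ i)
  ; E-sym = λ { (inj₁ (e , f)) → inj₂ (f , e) ; (inj₂ (e , f)) → inj₁ (f , e) }
  }

labelledHom-allFin : ∀ F G x → labelledHom F (allFin (Graph.order F)) G x ≡ 𝟙 (isHom? F G x)
labelledHom-allFin F G x = trans
  (∑-δ (maps-enumeration F G) (isLabelledHom? F (allFin _) G x) x
    λ {h} (_ , e) → trans (sym (Vec.map-lookup-allFin h)) e)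
  (𝟙-cong (isLabelledHom? F (allFin _) G x x) (isHom? F G x) proj₁ (_, Vec.map-lookup-allFin x))

labelledHom-edgeless : ∀ n G x → labelledHom (edgeless n) (allFin n) G x ≡ 1ℤ
labelledHom-edgeless n G x = trans (labelledHom-allFin (edgeless n) G x) (𝟙-yes (isHom? (edgeless n) G x) λ _ _ ())

labelledHom-singleEdge : ∀ n i j G x →
  labelledHom (singleEdge n i j) (allFin n) G x ≡ 𝟙 (Graph.E? G (lookup x i) (lookup x j))
labelledHom-singleEdge n i j G x = trans (labelledHom-allFin (singleEdge n i j) G x)
  (𝟙-cong (isHom? (singleEdge n i j) G x) (Graph.E? G (lookup x i) (lookup x j))
    (λ hom → hom i j (inj₁ (refl , refl)))
    λ { e _ _ (inj₁ (refl , refl)) → e ; e _ _ (inj₂ (refl , refl)) → Graph.E-sym G e })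

-- Contracting i and j amounts to gluing both of them to a single point.
module Contraction (n : ℕ) (i j : Fin n) where

  private
    points : Vec (Fin n) 2
    points = i ∷ j ∷ []

    glued = gluing (edgeless n) (edgeless 1) points (zero ∷ zero ∷ [])

  contraction : Graph
  contraction = proj₁ glued

  private
    p : Fin n ⊎ Fin 1 → V contraction
    p = proj₁ (proj₂ glued)
    isGluing = proj₂ (proj₂ glued)
    open IsGluing isGluing

  contraction-labels : Vec (V contraction) n
  contraction-labels = map (p ∘ inj₁) (allFin n)

  labelled : ∀ v → v ∈ contraction-labels
  labelled v with surjective v
  ... | inj₁ u    , refl = ∈.∈-map⁺ (p ∘ inj₁) (∈.∈-allFin⁺ u)
  -- The auxiliary point is identified with `i`, hence carries its label.
  ... | inj₂ zero , refl = subst (_∈ contraction-labels)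
    (Equivalence.from (kernel (inj₁ i) (inj₂ zero)) (fwd (identified zero) ◅ ε)) (∈.∈-map⁺ (p ∘ inj₁) (∈.∈-allFin⁺ i))

  labelledHom-contraction : ∀ G x →
    labelledHom contraction contraction-labels G x ≡ 𝟙 (lookup x i ≟ lookup x j)
  labelledHom-contraction G x = trans
    (∑-δ (maps-enumeration contraction G) (isLabelledHom? contraction contraction-labels G x)
      (extend isGluing G x y) unique)
    (𝟙-cong (isLabelledHom? contraction contraction-labels G x (extend isGluing G x y)) (lookup x i ≟ lookup x j)
      (λ (_ , e) → let c = compatible (extend isGluing G x y) e in
        trans (cong Vec.head c) (sym (cong (Vec.head ∘ Vec.tail) c)))
      λ e → let c = cong (λ k → lookup x i ∷ k ∷ []) (sym e) in
        extend-hom isGluing G x y c (λ _ _ ()) (λ _ _ ()) ,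
        trans (map-restrictˡ isGluing G (extend isGluing G x y) (allFin n))
          (trans (Vec.map-lookup-allFin _) (restrictˡ-extend isGluing G x y c)))
    where
    y : Vec (V G) 1
    y = lookup x i ∷ []

    restrictˡ≡x : ∀ h → map (lookup h) contraction-labels ≡ x → restrictˡ isGluing G h ≡ x
    restrictˡ≡x h e = trans (sym (Vec.map-lookup-allFin (restrictˡ isGluing G h)))
      (trans (sym (map-restrictˡ isGluing G h (allFin n))) e)

    compatible : ∀ h → map (lookup h) contraction-labels ≡ x →
                 map (lookup x) points ≡ map (lookup (restrictʳ isGluing G h)) (zero ∷ zero ∷ [])
    compatible h e = subst (λ k → map (lookup k) points ≡ map (lookup (restrictʳ isGluing G h)) (zero ∷ zero ∷ []))
      (restrictˡ≡x h e) (restrict-compatible isGluing G h)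

    unique : ∀ {h} → IsLabelledHom contraction contraction-labels G x h → h ≡ extend isGluing G x y
    unique {h} (_ , e) = trans (sym (extend-restrict isGluing G h)) (cong₂ (extend isGluing G) (restrictˡ≡x h e)
      (lookup-ext {x = restrictʳ isGluing G h} {y} λ { zero → sym (cong Vec.head (compatible h e)) }))

-- Homomorphism counts span a coherent algebra

module _ (t : ℕ) (𝔾 : Bool → Graph) where

  Generated : Set₁
  Generated = ∃ (𝓛⁺ t)

  homValue : Generated → Fn (Point t 𝔾)
  homValue (F , _) s = homᵇ F (𝔾 s)

  hom-isBasis : IsBasis t 𝔾 homValue
  hom-isBasis = record
    { one      =
                 equiv (λ s x → trans (homᵇ-withLabels t (edgeless _) (allFin _) (𝔾 s) x)
                                     (labelledHom-edgeless (t ℕ.+ t) (𝔾 s) x))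
                       (basic (_ , atomic-withLabels t (edgeless _) (allFin _) ∈.∈-allFin⁺))
    ; equal    = λ i j → let open Contraction (t ℕ.+ t) i j in
                 equiv (λ s x → trans (homᵇ-withLabels t contraction contraction-labels (𝔾 s) x)
                                     (labelledHom-contraction (𝔾 s) x))
                       (basic (_ , atomic-withLabels t contraction contraction-labels labelled))
    ; adjacent = λ i j →
                 equiv (λ s x → trans (homᵇ-withLabels t (singleEdge _ i j) (allFin _) (𝔾 s) x)
                                     (labelledHom-singleEdge (t ℕ.+ t) i j (𝔾 s) x))
                       (basic (_ , atomic-withLabels t (singleEdge _ i j) (allFin _) ∈.∈-allFin⁺))
    ; mul      = λ (F , F∈) (F′ , F′∈) →
                 let K , p , gl = gluing (graph F) (graph F′) (labels F) (labels F′)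
                     isParallel = p , gl , refl , refl
                 in equiv (λ s → homᵇ-parallel {F = F} {F′} (𝔾 s) isParallel) (basic (_ , parallel F∈ F′∈ isParallel))
    -- Permuting labels acts on the argument by the inverse permutation, so the labels are permuted
    -- by the inverse of `σ`.
    ; perm     = λ σ (F , F∈) →
                 equiv (λ s → homᵇ-permuted (Perm.flip σ) F (𝔾 s)) (basic (_ , permuted (Perm.flip σ) F∈))
    ; compose  = λ (F , F∈) (F′ , F′∈) →
                 let K , p , gl = gluing (graph F) (graph F′) (outs F) (ins F′)
                     isSeries = p , gl , refl , refl
                 in equiv (λ s → homᵇ-series {F = F} {F′} (𝔾 s) isSeries) (basic (_ , series F∈ F′∈ isSeries))
    }

  allPairs-enumeration : ∀ s → IsEnumeration (allPairs t 𝔾 s)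
  allPairs-enumeration s
    with enum ← tuples-enumeration (Graph.order (𝔾 s)) t
    with u , c ← ×-enumeration enum enum =
    Uniqueˡ.map⁺ (λ {(x , y)} {(x′ , y′)} e → uncurry (cong₂ _,_) (Vec.++-injective x x′ e)) u ,
    λ x → subst (_∈ˡ allPairs t 𝔾 s) (Vec.take++drop≡id t x) (∈ˡ.∈-map⁺ (uncurry _++_) (c (take t x , drop t x)))

  -- Summing a labelled count over all points forgets the labels, so equality of homomorphism
  -- numbers says precisely that the generators are balanced.
  homIndistinguishable⇒notDistinguished :
    HomIndistinguishable t (𝔾 true) (𝔾 false) → MWL.NotDistinguished t (𝔾 true) (𝔾 false)
  homIndistinguishable⇒notDistinguished ind =
    balanced⇒notDistinguished t 𝔾 (Span-isCoherent t 𝔾 homValue hom-isBasis)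
    (Span-balanced t 𝔾 homValue λ (F , F∈) → trans
      (sym (hom-∑ (graph F) (labels F) (𝔾 true) (allPairs-enumeration true)))
      (trans (cong +_ (ind F F∈)) (hom-∑ (graph F) (labels F) (𝔾 false) (allPairs-enumeration false))))

-- Counting quantifiers

AtLeast-map : ∀ {n} {P Q : X → Set} → (∀ {x} → P x → Q x) → AtLeast n P → AtLeast n Q
AtLeast-map f (ys , u , all) = ys , u , All.map f all

AtLeast-cong : ∀ {n} {P Q : X → Set} → (∀ x → P x ⇔ Q x) → AtLeast n P ⇔ AtLeast n Q
AtLeast-cong eq = mk⇔ (AtLeast-map (Equivalence.to (eq _))) (AtLeast-map (Equivalence.from (eq _)))

unique⇒≤length : ∀ {n} {ys : Vec X n} {zs} → Unique ys → All (_∈ˡ zs) ys → n ≤ length zs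
unique⇒≤length [] [] = z≤n
unique⇒≤length {ys = y ∷ ys} (y≢ ∷ u) (y∈ ∷ ys∈) with zs₁ , zs₂ , refl ← ∈ˡ.∈-∃++ y∈ =
  subst (suc _ ≤_) (↭.↭-length (↭-sym (↭.shift y zs₁ zs₂)))
    (s≤s (unique⇒≤length u (All.map
      (λ (y≢z , z∈) → remove y≢z (↭.∈-resp-↭ (↭.shift y zs₁ zs₂) z∈)) (All.zip (y≢ , ys∈)))))
  where
  remove : ∀ {z zs} → y ≢ z → z ∈ˡ (y ∷ zs) → z ∈ˡ zs
  remove y≢z (here refl) = contradiction refl y≢z
  remove y≢z (there z∈)  = z∈

prefix : ∀ n (zs : List X) → n ≤ length zs → Vec X n
prefix zero    zs       le       = []
prefix (suc n) (z ∷ zs) (s≤s le) = z ∷ prefix n zs le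

prefix-All : ∀ {P : X → Set} {n zs} le → Allˡ.All P zs → All P (prefix n zs le)
prefix-All {n = zero}  le       all         = []
prefix-All {n = suc n} (s≤s le) (pz ∷ all) = pz ∷ prefix-All le all

prefix-Unique : ∀ {n} {zs : List X} le → Uniqueˡ.Unique zs → Unique (prefix n zs le)
prefix-Unique {n = zero}  le       u        = []
prefix-Unique {n = suc n} (s≤s le) (z≢ ∷ u) = prefix-All le z≢ ∷ prefix-Unique le u

-- Distinct witnesses inject into the filtered enumeration; conversely, a prefix of that enumeration
-- is a vector of distinct witnesses.
AtLeast⇔≤ : ∀ {n xs} → IsEnumeration xs → {P : X → Set} (P? : Unary.Decidable P) →
            AtLeast n P ⇔ n ≤ length (filter P? xs)
AtLeast⇔≤ {xs = xs} (unique , complete) P? = mk⇔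
  (λ (ys , u , all) → unique⇒≤length u (All.map (λ p → ∈ˡ.∈-filter⁺ P? (complete _) p) all))
  (λ le → _ , prefix-Unique le (Uniqueˡ.filter⁺ P? unique) , prefix-All le (Allˡ.all-filter P? xs))

AtLeast? : ∀ n {xs} → IsEnumeration xs → {P : X → Set} → Unary.Decidable P → Dec (AtLeast n P)
AtLeast? n {xs} enum P? = Dec.map (⇔-sym (AtLeast⇔≤ enum P?)) (n ℕ.≤? length (filter P? xs))

-- Each of the two counts is itself a threshold that the other must then reach.
AtLeast⇔⇒∑≡ : ∀ {xs ys} → IsEnumeration xs → IsEnumeration ys →
  {P : X → Set} {Q : Y → Set} (P? : Unary.Decidable P) (Q? : Unary.Decidable Q) →
  (∀ n → AtLeast n P ⇔ AtLeast n Q) → ∑ xs (λ x → 𝟙 (P? x)) ≡ ∑ ys (λ y → 𝟙 (Q? y))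
AtLeast⇔⇒∑≡ {xs = xs} {ys} enumA enumB P? Q? eq = trans (sym (length-filter P? xs)) (trans
  (cong +_ (ℕ.≤-antisym (Equivalence.to same≤ ℕ.≤-refl) (Equivalence.from same≤ ℕ.≤-refl)))
  (length-filter Q? ys))
  where
  same≤ : ∀ {n} → n ≤ length (filter P? xs) ⇔ n ≤ length (filter Q? ys)
  same≤ = AtLeast⇔≤ enumB Q? ⇔-∘ (eq _ ⇔-∘ ⇔-sym (AtLeast⇔≤ enumA P?))

∑≡⇒AtLeast⇔ : ∀ {xs ys} → IsEnumeration xs → IsEnumeration ys →
  {P : X → Set} {Q : Y → Set} (P? : Unary.Decidable P) (Q? : Unary.Decidable Q) →
  ∑ xs (λ x → 𝟙 (P? x)) ≡ ∑ ys (λ y → 𝟙 (Q? y)) → ∀ n → AtLeast n P ⇔ AtLeast n Q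
∑≡⇒AtLeast⇔ {xs = xs} {ys} enumA enumB P? Q? eq n =
  ⇔-sym (AtLeast⇔≤ enumB Q?) ⇔-∘ (mk⇔ (subst (n ≤_) same) (subst (n ≤_) (sym same)) ⇔-∘ AtLeast⇔≤ enumA P?)
  where
  same : length (filter P? xs) ≡ length (filter Q? ys)
  same = ℤ.+-injective (trans (length-filter P? xs) (trans eq (sym (length-filter Q? ys))))

Sat? : ∀ G {k} (φ : Formula k) a → Dec (Sat G φ a)
Sat? G (i ≐ j)    a = lookup a i ≟ lookup a j
Sat? G (edge i j) a = Graph.E? G (lookup a i) (lookup a j)
Sat? G (not φ)    a = ¬? (Sat? G φ a)
Sat? G (φ and ψ)  a = Sat? G φ a ×-dec Sat? G ψ a
Sat? G (φ or ψ)   a = Sat? G φ a ⊎-dec Sat? G ψ a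
Sat? G (∃≥ n m φ) a = AtLeast? n (tuples-enumeration _ m) λ y → Sat? G φ (y ++ a)

-- The first N of the thresholds 1 ≤ c, 2 ≤ c, … sum up to c once c ≤ N.
thresholds : ℕ → ℕ → ℤ
thresholds zero    c = 0ℤ
thresholds (suc N) c = 𝟙 (suc N ℕ.≤? c) + thresholds N c

thresholds≡⊓ : ∀ N c → thresholds N c ≡ + (N ⊓ c)
thresholds≡⊓ zero    c = refl
thresholds≡⊓ (suc N) c with ℕ.<-≤-connex N c
... | inj₁ N<c = trans (cong₂ _+_ (𝟙-yes (suc N ℕ.≤? c) N<c) (thresholds≡⊓ N c))
  (cong +_ (trans (cong suc (ℕ.m≤n⇒m⊓n≡m (ℕ.<⇒≤ N<c))) (sym (ℕ.m≤n⇒m⊓n≡m N<c))))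
... | inj₂ c≤N = trans (cong₂ _+_ (𝟙-no (suc N ℕ.≤? c) (ℕ.≤⇒≯ c≤N)) (thresholds≡⊓ N c))
  (cong +_ (trans (ℕ.m≥n⇒m⊓n≡n c≤N) (sym (ℕ.m≥n⇒m⊓n≡n (ℕ.m≤n⇒m≤1+n c≤N)))))

-- Tuples of distinct variables under a quantifier

permute-Unique : ∀ {m} (σ : Permutation′ m) {x : Vec X m} → Unique x → Unique (permute σ x)
permute-Unique σ u = Unique.tabulate⁺ λ {i} {j} e →
  trans (sym (Perm.inverseˡ σ)) (trans (cong (Perm._⟨$⟩ˡ_ σ) (Unique.lookup-injective u _ _ e)) (Perm.inverseˡ σ))

module _ (m : ℕ) {k : ℕ} where

  bound-Unique : Unique (bound m k)
  bound-Unique = Unique.tabulate⁺ (Fin.↑ˡ-injective k _ _)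

  old-Unique : ∀ {l} {x : Vec (Fin k) l} → Unique x → Unique (old m x)
  old-Unique = Unique.map⁺ (Fin.↑ʳ-injective m _ _)

  bound≢old : ∀ {i : Fin m} {j : Fin k} → i ↑ˡ k ≢ m ↑ʳ j
  bound≢old {i} {j} e with () ← trans (sym (Fin.splitAt-↑ˡ m i k)) (trans (cong (splitAt m) e) (Fin.splitAt-↑ʳ m k j))

  old++bound-Unique : ∀ {l} {x : Vec (Fin k) l} → Unique x → Unique (old m x ++ bound m k)
  old++bound-Unique u = AllPairs.++⁺ (old-Unique u) bound-Unique
    (All.map⁺ (All.universal (λ _ → All.tabulate⁺ λ _ → bound≢old ∘ sym) _))

  bound++old-Unique : ∀ {l} {x : Vec (Fin k) l} → Unique x → Unique (bound m k ++ old m x)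
  bound++old-Unique u = AllPairs.++⁺ bound-Unique (old-Unique u)
    (All.tabulate⁺ λ _ → All.map⁺ (All.universal (λ _ → bound≢old) _))

  module _ {A : Set} (y : Vec A m) (a : Vec A k) where

    lookup-bound : map (lookup (y ++ a)) (bound m k) ≡ y
    lookup-bound = trans (sym (Vec.tabulate-∘ _ _)) (trans (Vec.tabulate-cong (Vec.lookup-++ˡ y a)) (Vec.tabulate∘lookup y))

    lookup-old : ∀ {l} (x : Vec (Fin k) l) → map (lookup (y ++ a)) (old m x) ≡ map (lookup a) x
    lookup-old x = trans (sym (Vec.map-∘ _ _ x)) (Vec.map-cong (Vec.lookup-++ʳ y a) x)

    lookup-old++bound : ∀ {l} (x : Vec (Fin k) l) → map (lookup (y ++ a)) (old m x ++ bound m k) ≡ map (lookup a) x ++ y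
    lookup-old++bound x = trans (Vec.map-++ _ (old m x) _) (cong₂ _++_ (lookup-old x) lookup-bound)

    lookup-bound++old : ∀ {l} (x : Vec (Fin k) l) → map (lookup (y ++ a)) (bound m k ++ old m x) ≡ y ++ map (lookup a) x
    lookup-bound++old x = trans (Vec.map-++ _ (bound m k) _) (cong₂ _++_ lookup-bound (lookup-old x))

-- Truth values of formulae span a coherent algebra

module _ (t : ℕ) (t≥1 : t ≥ 1) (𝔾 : Bool → Graph) where

  -- Asking for a formula with any prescribed variables avoids renaming variables
  -- inside formulae.
  record Definable : Set₁ where
    field
      Holds  : ∀ s → Point t 𝔾 s → Set
      holds? : ∀ s x → Dec (Holds s x)
      define : ∀ {k} (x : Vec (Fin k) (t ℕ.+ t)) → Unique x →
               ∃ λ φ → MFormula t x φ × ∀ s a → Sat (𝔾 s) φ a ⇔ Holds s (map (lookup a) x)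
  open Definable

  truthValue : Definable → Fn (Point t 𝔾)
  truthValue d s x = 𝟙 (holds? d s x)

  private
    transport : ∀ {ℓ} {A : Set ℓ} (P : A → Set) {x y} → x ≡ y → P x ⇔ P y
    transport P e = mk⇔ (subst P e) (subst P (sym e))

  equalᵈ adjacentᵈ : Fin (t ℕ.+ t) → Fin (t ℕ.+ t) → Definable
  equalᵈ i j = record
    { Holds  = λ s x → lookup x i ≡ lookup x j
    ; holds? = λ s x → lookup x i ≟ lookup x j
    ; define = λ x u →
               lookup x i ≐ lookup x j , quantifierFree u (∈.∈-lookup i x ≐ ∈.∈-lookup j x) , λ s a →
               transport (uncurry _≡_) (cong₂ _,_ (sym (Vec.lookup-map i _ x)) (sym (Vec.lookup-map j _ x)))
    }
  adjacentᵈ i j = record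
    { Holds  = λ s x → Graph.E (𝔾 s) (lookup x i) (lookup x j)
    ; holds? = λ s x → Graph.E? (𝔾 s) (lookup x i) (lookup x j)
    ; define = λ x u →
               edge (lookup x i) (lookup x j) , quantifierFree u (edge (∈.∈-lookup i x) (∈.∈-lookup j x)) , λ s a →
               transport (uncurry (Graph.E (𝔾 s))) (cong₂ _,_ (sym (Vec.lookup-map i _ x)) (sym (Vec.lookup-map j _ x)))
    }

  _∧ᵈ_ : Definable → Definable → Definable
  d ∧ᵈ e = record
    { Holds  = λ s x → Holds d s x × Holds e s x
    ; holds? = λ s x → holds? d s x ×-dec holds? e s x
    ; define = λ x u → let φ , φ∈ , sat = define d x u ; ψ , ψ∈ , sat′ = define e x u in
               φ and ψ , φ∈ and ψ∈ , λ s a → sat s a ×-⇔ sat′ s a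
    }

  permuteᵈ : Permutation′ (t ℕ.+ t) → Definable → Definable
  permuteᵈ σ d = record
    { Holds  = λ s x → Holds d s (permute σ x)
    ; holds? = λ s x → holds? d s (permute σ x)
    ; define = λ x u → let φ , φ∈ , sat = define d (permute σ x) (permute-Unique σ u) in
               -- The formula is requested for the permuted variables; reordering by the inverse
               -- restores the tuple `x` without touching the formula.
               φ , subst (λ z → MFormula t z φ) (permute-flip′ σ x) (reorder (Perm.flip σ) φ∈) ,
               λ s a → transport (Holds d s) (permute-map σ (lookup a) x) ⇔-∘ sat s a
    }

  module _ (d e : Definable) where

    Joins : ∀ s → Point t 𝔾 s → Vec (V (𝔾 s)) t → Set
    Joins s x y = Holds d s (take t x ++ y) × Holds e s (y ++ drop t x)

    joins? : ∀ s x y → Dec (Joins s x y)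
    joins? s x y = holds? d s (take t x ++ y) ×-dec holds? e s (y ++ drop t x)

    count : ∀ s → Point t 𝔾 s → ℕ
    count s x = length (filter (joins? s x) (allTuples t 𝔾 s))

    composeᵈ : ℕ → Definable
    composeᵈ n = record
      { Holds  = λ s x → AtLeast n (Joins s x)
      ; holds? = λ s x → AtLeast? n (tuples-enumeration _ t) (joins? s x)
      ; define = λ x u →
        -- Both formulae are requested directly in the scope enlarged by the middle tuple, whose
        -- bound variables come last for the left factor and first for the right one.
        let φ , φ∈ , sat = define d (old t (take t x) ++ bound t _) (old++bound-Unique t (Unique.take⁺ t u))
            ψ , ψ∈ , sat′ = define e (bound t _ ++ old t (drop t x)) (bound++old-Unique t (Unique.drop⁺ t u))
        in ∃≥ n t (φ and ψ) ,
           subst (λ z → MFormula t z (∃≥ n t (φ and ψ))) (Vec.take++drop≡id t x)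
             (∃≥ n (subst Unique (sym (Vec.take++drop≡id t x)) u) φ∈ ψ∈) ,
           λ s a → AtLeast-cong λ y →
             (transport (Holds d s) (trans (lookup-old++bound t y a (take t x))
                (cong (_++ y) (sym (Vec.take-map (lookup a) t x)))) ⇔-∘ sat s (y ++ a))
             ×-⇔
             (transport (Holds e s) (trans (lookup-bound++old t y a (drop t x))
                (cong (y ++_) (sym (Vec.drop-map (lookup a) t x)))) ⇔-∘ sat′ s (y ++ a))
      }

    truthValue-∙ : ∀ s x → _∙_ t 𝔾 (truthValue d) (truthValue e) s x ≡ + count s x
    truthValue-∙ s x = trans
      (∑-cong (allTuples t 𝔾 s) λ y → sym (𝟙-× (holds? d s (take t x ++ y)) (holds? e s (y ++ drop t x))))
      (sym (length-filter (joins? s x) (allTuples t 𝔾 s)))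

    -- The number of thresholds to be summed must not depend on the point or the graph, for the sum
    -- to be a single linear combination; the larger number of t-tuples serves.
    count-bound : ∃ λ N → ∀ s x → count s x ≤ N
    count-bound = size true ⊔ size false , λ where
        true  x → ℕ.≤-trans (List.length-filter (joins? true x) (allTuples t 𝔾 true))
                            (ℕ.m≤m⊔n (size true) (size false))
        false x → ℕ.≤-trans (List.length-filter (joins? false x) (allTuples t 𝔾 false))
                            (ℕ.m≤n⊔m (size true) (size false))
      where
      size : Bool → ℕ
      size s = length (allTuples t 𝔾 s)

  -- The constant 1 arises as the truth value of an equation between a variable and itself. This is
  -- where `t≥1` enters: it provides a variable.
  definable-one : Span t 𝔾 truthValue λ _ _ → 1ℤ
  definable-one = equiv (λ s x → 𝟙-yes (lookup x i ≟ lookup x i) refl) (basic (equalᵈ i i))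
    where
    i : Fin (t ℕ.+ t)
    i = inject≤ (zero {0}) (ℕ.≤-trans t≥1 (ℕ.m≤m+n t t))

  definable-isBasis : IsBasis t 𝔾 truthValue
  definable-isBasis = record
    { one      = definable-one
    ; equal    = λ i j → basic (equalᵈ i j)
    ; adjacent = λ i j → basic (adjacentᵈ i j)
    ; mul      = λ d e → equiv (λ s x → 𝟙-× (holds? d s x) (holds? e s x)) (basic (d ∧ᵈ e))
    ; perm     = λ σ d → basic (permuteᵈ σ d)
    ; compose  = λ d e → let N , count≤N = count-bound d e in
        equiv (λ s x → trans (thresholds≡⊓ N (count d e s x))
          (trans (cong +_ (ℕ.m≥n⇒m⊓n≡n (count≤N s x))) (sym (truthValue-∙ d e s x))))
          (thresholds-Span d e N)
    }
    where
    thresholds-Span : ∀ d e N → Span t 𝔾 truthValue λ s x → thresholds N (count d e s x)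
    thresholds-Span d e zero    = scale 0ℤ definable-one
    thresholds-Span d e (suc N) = equiv
      (λ s x → 𝟙-cong (holds? (composeᵈ d e (suc N)) s x) (suc N ℕ.≤? count d e s x)
        (Equivalence.to (AtLeast⇔≤ (tuples-enumeration _ t) (joins? d e s x)))
        (Equivalence.from (AtLeast⇔≤ (tuples-enumeration _ t) (joins? d e s x))))
      (basic (composeᵈ d e (suc N)))
      ⊕ thresholds-Span d e N

  mEquivalent⇒notDistinguished : MEquivalent t (𝔾 true) (𝔾 false) → MWL.NotDistinguished t (𝔾 true) (𝔾 false)
  mEquivalent⇒notDistinguished equivalent =
    balanced⇒notDistinguished t 𝔾 (Span-isCoherent t 𝔾 truthValue definable-isBasis)
    (Span-balanced t 𝔾 truthValue λ d →
      AtLeast⇔⇒∑≡ (allPairs-enumeration t 𝔾 true) (allPairs-enumeration t 𝔾 false)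
        (holds? d true) (holds? d false) (balanced d))
    where
    balanced : ∀ d n → AtLeast n (Holds d true) ⇔ AtLeast n (Holds d false)
    balanced d n =
      -- With no outer variables in scope, the 2t bound variables are the free variables of `φ`, so
      -- prefixing the quantifier gives a sentence.
      let φ , φ∈ , sat = define d (bound (t ℕ.+ t) 0) (bound-Unique (t ℕ.+ t))
          sat′ : ∀ s → AtLeast n (λ y → Sat (𝔾 s) φ (y ++ [])) ⇔ AtLeast n (Holds d s)
          sat′ s = AtLeast-cong λ y → transport (Holds d s) (lookup-bound (t ℕ.+ t) y []) ⇔-∘ sat s (y ++ [])
      in sat′ false ⇔-∘ (equivalent (∃≥ n φ∈) ⇔-∘ ⇔-sym (sat′ true))

-- What atomic types determine

private
  does≡⇒ : ∀ {P Q : Set} (p : Dec P) (q : Dec Q) → does p ≡ does q → P → Q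
  does≡⇒ (yes _) (yes q) _  _ = q
  does≡⇒ (no ¬p) _       _  p = contradiction p ¬p

module _ (G H : Graph) {m} (x : Vec (V G) m) (y : Vec (V H) m) (same : atp G x ≡ atp H y) where

  private
    entry : ∀ i j → (does (lookup x i ≟ lookup x j) , does (Graph.E? G (lookup x i) (lookup x j)))
                  ≡ (does (lookup y i ≟ lookup y j) , does (Graph.E? H (lookup y i) (lookup y j)))
    entry i j = trans (sym (lookup-atp G x)) (trans (cong (λ a → lookup (lookup a i) j) same) (lookup-atp H y))
      where
      lookup-atp : ∀ G x → lookup (lookup (atp G x) i) j
                   ≡ (does (lookup x i ≟ lookup x j) , does (Graph.E? G (lookup x i) (lookup x j)))
      lookup-atp G x = trans (cong (λ r → lookup r j) (Vec.lookup∘tabulate _ i)) (Vec.lookup∘tabulate _ j)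

  atp-equal : ∀ i j → lookup x i ≡ lookup x j → lookup y i ≡ lookup y j
  atp-equal i j = does≡⇒ (lookup x i ≟ lookup x j) (lookup y i ≟ lookup y j) (cong proj₁ (entry i j))

  atp-adjacent : ∀ i j → Graph.E G (lookup x i) (lookup x j) → Graph.E H (lookup y i) (lookup y j)
  atp-adjacent i j =
    does≡⇒ (Graph.E? G (lookup x i) (lookup x j)) (Graph.E? H (lookup y i) (lookup y j)) (cong proj₂ (entry i j))

  -- The only candidate map reads its values off the tuple. Whether it preserves edges and matches
  -- the labels therefore depends on equalities and adjacencies among the entries alone.
  atp-labelledHom : ∀ {F} (l : Vec (V F) m) (labelled : ∀ v → v ∈ l) →
    IsLabelledHom F l G x (fromLabels {F} l labelled G x) → IsLabelledHom F l H y (fromLabels {F} l labelled H y)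
  atp-labelledHom {F} l labelled (hom , e) =
    (λ v w vw → subst₂ (Graph.E H) (sym (value H y v)) (sym (value H y w))
      (atp-adjacent _ _ (subst₂ (Graph.E G) (value G x v) (value G x w) (hom v w vw)))) ,
    lookup-ext λ i → begin
      lookup (map (lookup (fromLabels {F} l labelled H y)) l) i ≡⟨ Vec.lookup-map i _ l ⟩
      lookup (fromLabels {F} l labelled H y) (lookup l i)       ≡⟨ value H y _ ⟩
      -- A vertex may carry several labels, so the chosen index need not be `i`. The entries of `x`
      -- at both positions agree by `e`, and the atomic type transfers this to `y`.
      lookup y (Any.index (labelled (lookup l i)))          ≡⟨ atp-equal _ _ (trans (sym (value G x _))
        (trans (sym (Vec.lookup-map i _ l)) (cong (λ z → lookup z i) e))) ⟩
      lookup y i                                            ∎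
    where
    open ≡-Reasoning
    value : ∀ G x v → lookup (fromLabels {F} l labelled G x) v ≡ lookup x (Any.index (labelled v))
    value G x v = Vec.lookup∘tabulate _ v

module _ {G H : Graph} {k m} (z : Vec (Fin k) m) (a : Vec (V G) k) (b : Vec (V H) k)
         (same : atp G (map (lookup a) z) ≡ atp H (map (lookup b) z)) where

  private
    at : ∀ {A : Set} (a : Vec A k) {i} (i∈ : i ∈ z) → lookup (map (lookup a) z) (Any.index i∈) ≡ lookup a i
    at a i∈ = trans (Vec.lookup-map (Any.index i∈) (lookup a) z) (cong (lookup a) (sym (Any.lookup-index i∈)))

  atp-equal-variables : ∀ {i j} → i ∈ z → j ∈ z → lookup a i ≡ lookup a j → lookup b i ≡ lookup b j
  atp-equal-variables i∈ j∈ e =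
    trans (sym (at b i∈)) (trans
      (atp-equal G H (map (lookup a) z) (map (lookup b) z) same _ _ (trans (at a i∈) (trans e (sym (at a j∈)))))
      (at b j∈))

  atp-adjacent-variables : ∀ {i j} → i ∈ z → j ∈ z →
    Graph.E G (lookup a i) (lookup a j) → Graph.E H (lookup b i) (lookup b j)
  atp-adjacent-variables i∈ j∈ e = subst₂ (Graph.E H) (at b i∈) (at b j∈)
    (atp-adjacent G H (map (lookup a) z) (map (lookup b) z) same _ _
      (subst₂ (Graph.E G) (sym (at a i∈)) (sym (at a j∈)) e))

-- Colours determine counts and truth values

module _ (t : ℕ) (𝔾 : Bool → Graph) where
  open MWL t

  private
    G H : Graph
    G = 𝔾 true
    H = 𝔾 false

  -- Wrapping the equality keeps `x`, `i` and `y` visible to unification, whereas the equality of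
  -- colours itself unfolds by recursion on `i`.
  record _≈[_]_ (x : Vec (V G) (t ℕ.+ t)) (i : ℕ) (y : Vec (V H) (t ℕ.+ t)) : Set where
    constructor sameColour
    field colour : Setoid._≈_ (Colour i) (mwl G i x) (mwl H i y)

  ≈-permute : ∀ {i x y} → x ≈[ suc i ] y → ∀ σ → permute σ x ≈[ i ] permute σ y
  ≈-permute (sameColour (half , _)) σ = sameColour (half σ)

  permute-id : ∀ {A : Set} {n} (x : Vec A n) → permute Perm.id x ≡ x
  permute-id = Vec.tabulate∘lookup

  half⇒≈ : ∀ {i x y} → (∀ σ → permute σ x ≈[ i ] permute σ y) → x ≈[ i ] y
  half⇒≈ {i} {x} {y} half = subst₂ (_≈[ i ]_) (permute-id x) (permute-id y) (half Perm.id)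

  -- Each round refines the previous one, because the family over all permutations contains the old
  -- colour at the identity.
  ≈-≤ : ∀ {i j x y} → i ≤ j → x ≈[ j ] y → x ≈[ i ] y
  ≈-≤ = go ∘ ℕ.≤⇒≤′
    where
    go : ∀ {i j x y} → i ≤′ j → x ≈[ j ] y → x ≈[ i ] y
    go ≤′-refl     e = e
    go (≤′-step p) e = go p (half⇒≈ (≈-permute e))

  ≈-split : ∀ {i x y} → x ≈[ suc i ] y →
    Match (λ u v → (take t x ++ u) ≈[ i ] (take t y ++ v) × (u ++ drop t x) ≈[ i ] (v ++ drop t y))
          (allTuples t 𝔾 true) (allTuples t 𝔾 false)
  ≈-split {i} (sameColour (_ , p)) =
    Match-map (λ (l , r) → half⇒≈ (λ σ → sameColour (l σ)) , half⇒≈ (λ σ → sameColour (r σ)))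
      (↭⇒Match {S = ×-setoid (Half (Colour i)) (Half (Colour i))} p)

  -- Atomic graphs need no round and parallel composition no additional one; series composition and
  -- a permutation of labels cost one round each. The number of rounds depends on the construction
  -- of `F`, not on the tuples.
  ≈⇒homᵇ : ∀ {F} → 𝓛⁺ t F → ∃ λ i → ∀ {x y} → x ≈[ i ] y → homᵇ F G x ≡ homᵇ F H y
  ≈⇒homᵇ (atomic {F} labelled) = 0 , λ {x} {y} (sameColour same) → begin
    homᵇ F G x ≡⟨ labelledHom-atomic {graph F} (labels F) labelled G x ⟩
    _          ≡⟨ 𝟙-cong (isLabelledHom? (graph F) (labels F) G x (fromLabels {graph F} (labels F) labelled G x))
                         (isLabelledHom? (graph F) (labels F) H y (fromLabels {graph F} (labels F) labelled H y))
                    (atp-labelledHom G H x y same {graph F} (labels F) labelled)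
                    (atp-labelledHom H G y x (sym same) {graph F} (labels F) labelled) ⟩
    _          ≡⟨ labelledHom-atomic {graph F} (labels F) labelled H y ⟨
    homᵇ F H y ∎
    where open ≡-Reasoning
  ≈⇒homᵇ (parallel {F} {F′} F∈ F′∈ isParallel)
    with i , eq ← ≈⇒homᵇ F∈ | j , eq′ ← ≈⇒homᵇ F′∈ = i ⊔ j , λ {x} {y} x≈y →
      trans (homᵇ-parallel {F = F} {F′} G isParallel x) (trans
        (cong₂ _*_ (eq (≈-≤ (ℕ.m≤m⊔n i j) x≈y)) (eq′ (≈-≤ (ℕ.m≤n⊔m i j) x≈y)))
        (sym (homᵇ-parallel {F = F} {F′} H isParallel y)))
  ≈⇒homᵇ (series {F} {F′} F∈ F′∈ isSeries)
    with i , eq ← ≈⇒homᵇ F∈ | j , eq′ ← ≈⇒homᵇ F′∈ = suc (i ⊔ j) , λ {x} {y} x≈y →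
      trans (homᵇ-series {F = F} {F′} G isSeries x) (trans
        (∑-Match (λ (l , r) → cong₂ _*_ (eq (≈-≤ (ℕ.m≤m⊔n i j) l)) (eq′ (≈-≤ (ℕ.m≤n⊔m i j) r))) (≈-split x≈y))
        (sym (homᵇ-series {F = F} {F′} H isSeries y)))
  ≈⇒homᵇ (permuted {F} σ F∈) with i , eq ← ≈⇒homᵇ F∈ = suc i , λ {x} {y} x≈y →
    trans (homᵇ-permuted σ F G x) (trans (eq (≈-permute x≈y (Perm.flip σ))) (sym (homᵇ-permuted σ F H y)))

  -- The assignments may differ arbitrarily outside `z`, which is what allows the induction to go
  -- under a quantifier: each conjunct sees only half of the old tuple besides the bound one.
  -- Quantifiers and reorderings cost a round, Boolean connectives none.
  ≈⇒Sat : ∀ {k} {z : Vec (Fin k) (t ℕ.+ t)} {φ} → MFormula t z φ →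
          ∃ λ i → ∀ a b → map (lookup a) z ≈[ i ] map (lookup b) z → Sat G φ a ⇔ Sat H φ b
  ≈⇒Sat (quantifierFree {z} _ qf) = 0 , λ a b (sameColour same) → go a b same qf
    where
    go : ∀ a b → atp G (map (lookup a) z) ≡ atp H (map (lookup b) z) →
         ∀ {φ} → QuantifierFree z φ → Sat G φ a ⇔ Sat H φ b
    go a b same (i∈ ≐ j∈)    = mk⇔ (atp-equal-variables {G} {H} z a b same i∈ j∈)
                                   (atp-equal-variables {H} {G} z b a (sym same) i∈ j∈)
    go a b same (edge i∈ j∈) = mk⇔ (atp-adjacent-variables {G} {H} z a b same i∈ j∈)
                                   (atp-adjacent-variables {H} {G} z b a (sym same) i∈ j∈)
    go a b same (not q)      = let e = go a b same q in mk⇔ (_∘ Equivalence.from e) (_∘ Equivalence.to e)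
    go a b same (q and q′)   = go a b same q ×-⇔ go a b same q′
    go a b same (q or q′)    = go a b same q ⊎-⇔ go a b same q′
  ≈⇒Sat (not m) with i , eq ← ≈⇒Sat m = i , λ a b x≈y →
    let e = eq a b x≈y in mk⇔ (_∘ Equivalence.from e) (_∘ Equivalence.to e)
  ≈⇒Sat (m and m′) with i , eq ← ≈⇒Sat m | j , eq′ ← ≈⇒Sat m′ =
    i ⊔ j , λ a b x≈y → eq a b (≈-≤ (ℕ.m≤m⊔n i j) x≈y) ×-⇔ eq′ a b (≈-≤ (ℕ.m≤n⊔m i j) x≈y)
  ≈⇒Sat (m or m′) with i , eq ← ≈⇒Sat m | j , eq′ ← ≈⇒Sat m′ =
    i ⊔ j , λ a b x≈y → eq a b (≈-≤ (ℕ.m≤m⊔n i j) x≈y) ⊎-⇔ eq′ a b (≈-≤ (ℕ.m≤n⊔m i j) x≈y)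
  ≈⇒Sat (∃≥ n {x} {z} {φ} {ψ} _ m m′) with i , eq ← ≈⇒Sat m | j , eq′ ← ≈⇒Sat m′ = suc (i ⊔ j) , λ a b x≈y →
    -- The matching of middle tuples given by one round pairs `u` with `v` so that both satisfy the
    -- conjunction or neither does, whence the numbers of witnesses agree.
    ∑≡⇒AtLeast⇔ (tuples-enumeration _ t) (tuples-enumeration _ t)
      (λ u → Sat? G (φ and ψ) (u ++ a)) (λ v → Sat? H (φ and ψ) (v ++ b))
      (∑-Match (λ {u} {v} (l , r) →
        let e = eq (u ++ a) (v ++ b) (subst₂ (_≈[ i ]_)
                  (trans (cong (_++ u) (take-map-++ a x z)) (sym (lookup-old++bound t u a x)))
                  (trans (cong (_++ v) (take-map-++ b x z)) (sym (lookup-old++bound t v b x)))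
                  (≈-≤ (ℕ.m≤m⊔n i j) l))
                ×-⇔
                eq′ (u ++ a) (v ++ b) (subst₂ (_≈[ j ]_)
                  (trans (cong (u ++_) (drop-map-++ a x z)) (sym (lookup-bound++old t u a z)))
                  (trans (cong (v ++_) (drop-map-++ b x z)) (sym (lookup-bound++old t v b z)))
                  (≈-≤ (ℕ.m≤n⊔m i j) r))
        in 𝟙-cong (Sat? G (φ and ψ) (u ++ a)) (Sat? H (φ and ψ) (v ++ b)) (Equivalence.to e) (Equivalence.from e))
        (≈-split x≈y)) n
    where
    map-split : ∀ {A : Set} (a : Vec A _) (x z : Vec _ t) →
      take t (map (lookup a) (x ++ z)) ≡ map (lookup a) x × drop t (map (lookup a) (x ++ z)) ≡ map (lookup a) z
    map-split a x z = Vec.++-injective _ _ (trans (Vec.take++drop≡id t _) (Vec.map-++ (lookup a) x z))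
    take-map-++ : ∀ {A : Set} (a : Vec A _) (x z : Vec _ t) → take t (map (lookup a) (x ++ z)) ≡ map (lookup a) x
    take-map-++ a x z = proj₁ (map-split a x z)
    drop-map-++ : ∀ {A : Set} (a : Vec A _) (x z : Vec _ t) → drop t (map (lookup a) (x ++ z)) ≡ map (lookup a) z
    drop-map-++ a x z = proj₂ (map-split a x z)
  ≈⇒Sat (reorder {x} σ m) with i , eq ← ≈⇒Sat m = suc i , λ a b x≈y → eq a b (subst₂ (_≈[ i ]_)
    (back a) (back b) (≈-permute x≈y (Perm.flip σ)))
    where
    back : ∀ {A : Set} (a : Vec A _) → permute (Perm.flip σ) (map (lookup a) (permute σ x)) ≡ map (lookup a) x
    back a = trans (cong (permute (Perm.flip σ)) (permute-map σ (lookup a) x)) (permute-flip′ σ (map (lookup a) x))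

  module _ (same : NotDistinguished G H) where

    -- Equality of stable colours means equality in every round, so a single matching serves all `i`
    -- at once.
    stable-Match : Match (λ x y → ∀ i → x ≈[ i ] y) (allPairs t 𝔾 true) (allPairs t 𝔾 false)
    stable-Match = Match-map (λ x≈y i → sameColour (x≈y i)) (↭⇒Match {S = StableColour}
      (subst₂ (Permutation (Setoid._≈_ StableColour))
      (List.map-∘ (cartesianProduct (allTuples t 𝔾 true) (allTuples t 𝔾 true)))
      (List.map-∘ (cartesianProduct (allTuples t 𝔾 false) (allTuples t 𝔾 false))) same))

    notDistinguished⇒homIndistinguishable : HomIndistinguishable t G H
    notDistinguished⇒homIndistinguishable F F∈ with i , eq ← ≈⇒homᵇ F∈ = ℤ.+-injective (trans
      (hom-∑ (graph F) (labels F) G (allPairs-enumeration t 𝔾 true)) (trans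
      (∑-Match (λ x≈y → eq (x≈y i)) stable-Match)
      (sym (hom-∑ (graph F) (labels F) H (allPairs-enumeration t 𝔾 false)))))

    notDistinguished⇒mEquivalent : MEquivalent t G H
    notDistinguished⇒mEquivalent (∃≥ n {φ} m) with i , eq ← ≈⇒Sat m =
      ∑≡⇒AtLeast⇔ (allPairs-enumeration t 𝔾 true) (allPairs-enumeration t 𝔾 false)
        (λ x → Sat? G φ (x ++ [])) (λ y → Sat? H φ (y ++ []))
        (∑-Match (λ {x} {y} x≈y →
          let e = eq (x ++ []) (y ++ []) (subst₂ (_≈[ i ]_)
                (sym (lookup-bound (t ℕ.+ t) x [])) (sym (lookup-bound (t ℕ.+ t) y [])) (x≈y i))
          in 𝟙-cong (Sat? G φ (x ++ [])) (Sat? H φ (y ++ [])) (Equivalence.to e) (Equivalence.from e))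
          stable-Match) n

theorem5p3 : (t : ℕ) → t ≥ 1 → (G H : Graph) → Simple G → Simple H →
    (MWL.NotDistinguished t G H ⇔ HomIndistinguishable t G H) ×
    (HomIndistinguishable t G H ⇔ MEquivalent t G H)
theorem5p3 t t≥1 G H _ _ =
  mk⇔ (notDistinguished⇒homIndistinguishable t 𝔾) (homIndistinguishable⇒notDistinguished t 𝔾) ,
  -- Graphs and formulae are not translated into each other; both directions pass through the mwl
  -- algorithm.
  mk⇔ {B = MEquivalent t G H} (λ ind → notDistinguished⇒mEquivalent t 𝔾 (homIndistinguishable⇒notDistinguished t 𝔾 ind))
      (λ equivalent →
        notDistinguished⇒homIndistinguishable t 𝔾 (mEquivalent⇒notDistinguished t t≥1 𝔾 equivalent))
  where
  𝔾 : Bool → Graph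
  𝔾 true  = G
  𝔾 false = H
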